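{- Let $n,t,k_1,\ldots,k_{t+1}$ be positive integers with $k_1\ge k_2\ge\cdots\ge k_{t+1}\ge 2$ and $n\ge 2k_1^2k_2t$. Let $F_i\subseteq\binom{[n]}{k_i}$ for $i\in[t+1]$ be such that $$|F_i|>\binom{n}{k_i}-\binom{n-t}{k_i}-\binom{n-t-k_{3-i}}{k_i-1}+1\quad\text{for } i\in\{1,2\},$$ and $$|F_i|>\binom{n}{k_i}-\binom{n-t}{k_i}-\binom{n-t-k_{3}}{k_i-1}+1\quad\text{for } i\in[t+1]\setminus\{1,2\}.$$ Then either (i) $\{F_1,\ldots,F_{t+1}\}$ admits a rainbow matching of size $t+1$, or (ii) there exists $W\in\binom{[n]}{t}$ which is a vertex cover of $F_i$ for every $i\in[t+1]$.
   Context: $[n]=\{1,\ldots,n\}$ and $\binom{S}{j}$ is the family of $j$-element subsets of $S$. A rainbow matching of size $q$ for $\{F_1,\ldots,F_q\}$ is a choice of pairwise disjoint sets $e_i\in F_i$, $i\in[q]$. A vertex cover of a family $F$ of sets is a set meeting every member of $F$. (When $t=1$ the second condition is vacuous.) -}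

module Defs where

open import Data.Fin using (Fin; zero; suc)
open import Data.Fin.Subset using (Subset; ∣_∣; _∩_; Nonempty; Empty)
open import Data.List using (List; length)
open import Data.List.Membership.Propositional using (_∈_)
open import Data.List.Relation.Unary.All using (All)
open import Data.List.Relation.Unary.Unique.Propositional using (Unique)
open import Data.Nat using (ℕ; suc; _+_; _∸_)
open import Data.Nat.Combinatorics using (_C_)
open import Data.Product using (Σ-syntax; _×_)
open import Relation.Binary.PropositionalEquality using (_≡_; _≢_)

-- The ground set [n] is Fin n.  A family of k-element subsets is given by a
-- duplicate-free enumeration, so its cardinality is the length of the list.
record Family (n k : ℕ) : Set where
  field
    members : List (Subset n)
    unique  : Unique members
    uniform : All (λ A → ∣ A ∣ ≡ k) members

open Family public

card : ∀ {n k} → Family n k → ℕ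
card F = length (members F)

RainbowMatching : ∀ {n q} {k : Fin q → ℕ} → (∀ i → Family n (k i)) → Set
RainbowMatching {n} {q} F =
  Σ[ e ∈ (Fin q → Subset n) ]
    (∀ i → e i ∈ members (F i)) × (∀ i j → i ≢ j → Empty (e i ∩ e j))

VertexCover : ∀ {n k} → Subset n → Family n k → Set
VertexCover W F = All (λ A → Nonempty (W ∩ A)) (members F)

-- Indices are 0-based: the i-th object of the mathematical text, i ∈ [t+1],
-- has index i - 1.  The size bound for the i-th family involves, besides k_i,
-- the number k_{3-i} if i ∈ {1,2} and k_3 if i ≥ 3; partner returns the index
-- of that second number.  The last clause only arises for t ≥ 2.
partner : ∀ {s} → Fin (suc (suc s)) → Fin (suc (suc s))
partner zero                = suc zero
partner (suc zero)          = zero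
partner {suc _} (suc (suc _)) = suc (suc zero)

-- If 1 ≤ t, 2 ≤ k and t + l ≤ n, no subtraction here is truncated: then
-- (n C k) - ((n - t) C k) is the sum of (n - j) C (k - 1) over 1 ≤ j ≤ t,
-- which is at least (n - t - l) C (k - 1).
bound : (n t k l : ℕ) → ℕ
bound n t k l = (n C k) ∸ ((n ∸ t) C k) ∸ ((n ∸ t ∸ l) C (k ∸ 1)) + 1

{-# OPTIONS --safe #-}
-- Induction on t.  For t ≥ 2 the last family has a point x of large degree: by induction
-- the other families have a rainbow matching, and if it does not extend then the last
-- family is covered by the few points of that matching.  A rainbow matching of the other
-- families that avoids x extends by a member through x, so otherwise, by induction,
-- the members avoiding x have a common cover by t - 1 points, and adding x gives a common
-- t-cover W of all families but the last.  If a member A of the last family misses W, then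
-- the members of the other families that avoid A are too many to have a (t - 1)-cover,
-- hence have a rainbow matching, which A completes.
--
-- For t = 1 let F, G be cross-intersecting, and suppose that neither is a star (a common
-- point of F is also common to G, by counting).  The core of G at x is the set of points
-- common to all members of G that avoid x; a member of F through x meets the core, or it
-- contains two further points among few.  So the degrees of F are bounded by the sizes
-- of the cores of G, and vice versa.  The lower bounds on |F| and |G| then force cores
-- of size at most 2, and covers of size 2 exist; only k = l = 3 needs an exact count.
module Submission where

open import Defs
open import Data.Bool using (true; false; if_then_else_)
import Data.Bool as Bool
open import Data.Empty using (⊥)
open import Data.Fin using (Fin; zero; suc; fromℕ; inject₁)
import Data.Fin as Fin
import Data.Fin.Properties as Fin
open import Data.Fin.Relation.Unary.Top using (View; view; ‵fromℕ; ‵inject₁)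
open import Data.Fin.Subset
  using (Subset; inside; outside; ∣_∣; _∈_; _∉_; _⊆_; _∩_; _∪_; _─_; _-_; ⁅_⁆; Nonempty; Empty)
  renaming (⊥ to ∅; ⊤ to full)
open import Data.Fin.Subset.Properties
open import Data.List using (List; []; _∷_; length)
import Data.List.Membership.DecPropositional as DecMembership
open import Data.List.Membership.Propositional using () renaming (_∈_ to _∈ˡ_)
open import Data.List.Relation.Unary.All using (All; []; _∷_)
import Data.List.Relation.Unary.All as All
open import Data.List.Relation.Unary.AllPairs using ([]; _∷_)
open import Data.List.Relation.Unary.Unique.Propositional using (Unique)
open import Data.Nat
open import Data.Nat.Combinatorics using (_C_; nCk+nC[k+1]≡[n+1]C[k+1]; nC1≡n)
open import Data.Nat.Combinatorics.Specification using (k>n⇒nCk≡0)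
open import Data.Nat.Properties
open import Data.Nat.Tactic.RingSolver using (solve-∀)
open import Data.Product using (_×_; _,_; proj₁; proj₂; ∃; ∃-syntax; Σ-syntax)
open import Data.Sum using (_⊎_; inj₁; inj₂)
open import Data.Vec using ([]; _∷_; here; there; tabulate)
import Data.Vec.Properties as Vec
open import Function using (_∘_; id)
open import Level using (0ℓ)
open import Relation.Binary.Definitions using (Antitonic₁)
open import Relation.Binary.PropositionalEquality
open import Relation.Nullary using (¬_; Dec; does; yes; no; contradiction; ¬?; decidable-stable)
open import Relation.Nullary.Decidable using (_×-dec_; dec-true)
import Relation.Unary as U
open import Relation.Unary.Properties using (_∩?_; ∁?)

-- Counting the subsets of `Fin N` with a decidable property.

-- Families are handled as decidable predicates, so that subfamilies are intersections such as
-- `P? ∩? Q?` and no lists have to be filtered.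
cnt : ∀ {N} {P : U.Pred (Subset N) 0ℓ} → U.Decidable P → ℕ
cnt {zero} P? = if does (P? []) then 1 else 0
cnt {suc N} P? = cnt (P? ∘ (inside ∷_)) + cnt (P? ∘ (outside ∷_))

interchange : ∀ a b c d → (a + b) + (c + d) ≡ (a + c) + (b + d)
interchange = solve-∀

cnt-cover : ∀ {N} {P Q R : U.Pred (Subset N) 0ℓ}
  (P? : U.Decidable P) (Q? : U.Decidable Q) (R? : U.Decidable R) →
  (∀ {S} → P S → Q S ⊎ R S) → cnt P? ≤ cnt Q? + cnt R?
cnt-cover {zero} P? Q? R? h with P? [] | Q? [] | R? []
... | no _  | _     | _     = z≤n
... | yes _ | yes _ | _     = s≤s z≤n
... | yes _ | no _  | yes _ = ≤-refl
... | yes p | no ¬q | no ¬r with h p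
...   | inj₁ q = contradiction q ¬q
...   | inj₂ r = contradiction r ¬r
cnt-cover {suc N} P? Q? R? h = ≤-trans
  (+-mono-≤ (cnt-cover (P? ∘ (inside ∷_)) (Q? ∘ (inside ∷_)) (R? ∘ (inside ∷_)) h)
            (cnt-cover (P? ∘ (outside ∷_)) (Q? ∘ (outside ∷_)) (R? ∘ (outside ∷_)) h))
  (≤-reflexive (interchange (cnt (Q? ∘ (inside ∷_))) _ _ _))

cnt-disjoint : ∀ {N} {P Q R : U.Pred (Subset N) 0ℓ}
  (P? : U.Decidable P) (Q? : U.Decidable Q) (R? : U.Decidable R) →
  (∀ {S} → Q S → P S) → (∀ {S} → R S → P S) → (∀ {S} → Q S → ¬ R S) →
  cnt Q? + cnt R? ≤ cnt P?
cnt-disjoint {zero} P? Q? R? f g d with P? [] | Q? [] | R? []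
... | yes _ | yes q | yes r = contradiction r (d q)
... | yes _ | yes _ | no _  = ≤-refl
... | yes _ | no _  | yes _ = ≤-refl
... | yes _ | no _  | no _  = z≤n
... | no ¬p | yes q | _     = contradiction (f q) ¬p
... | no ¬p | no _  | yes r = contradiction (g r) ¬p
... | no _  | no _  | no _  = ≤-refl
cnt-disjoint {suc N} P? Q? R? f g d = ≤-trans
  (≤-reflexive (interchange (cnt (Q? ∘ (inside ∷_))) _ _ _))
  (+-mono-≤ (cnt-disjoint (P? ∘ (inside ∷_)) (Q? ∘ (inside ∷_)) (R? ∘ (inside ∷_)) f g d)
            (cnt-disjoint (P? ∘ (outside ∷_)) (Q? ∘ (outside ∷_)) (R? ∘ (outside ∷_)) f g d))

cnt-none : ∀ {N} {P : U.Pred (Subset N) 0ℓ} (P? : U.Decidable P) → (∀ {S} → ¬ P S) → cnt P? ≡ 0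
cnt-none {zero} P? h with P? []
... | yes p = contradiction p h
... | no _  = refl
cnt-none {suc N} P? h =
  cong₂ _+_ (cnt-none (P? ∘ (inside ∷_)) h) (cnt-none (P? ∘ (outside ∷_)) h)

cnt-mono : ∀ {N} {P Q : U.Pred (Subset N) 0ℓ} (P? : U.Decidable P) (Q? : U.Decidable Q) →
  (∀ {S} → P S → Q S) → cnt P? ≤ cnt Q?
cnt-mono {N} P? Q? h = ≤-trans (cnt-cover P? Q? none? (inj₁ ∘ h))
  (≤-reflexive (trans (cong (cnt Q? +_) (cnt-none none? id)) (+-identityʳ _)))
  where
  none? : U.Decidable {A = Subset N} (λ _ → ⊥)
  none? _ = no id

cnt-cong : ∀ {N} {P Q : U.Pred (Subset N) 0ℓ} (P? : U.Decidable P) (Q? : U.Decidable Q) →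
  (∀ {S} → P S → Q S) → (∀ {S} → Q S → P S) → cnt P? ≡ cnt Q?
cnt-cong P? Q? f g = ≤-antisym (cnt-mono P? Q? f) (cnt-mono Q? P? g)

cnt-any : ∀ {N} {P : U.Pred (Subset N) 0ℓ} (P? : U.Decidable P) {S} → P S → 1 ≤ cnt P?
cnt-any {zero} P? {[]} p with P? []
... | yes _ = ≤-refl
... | no ¬p = contradiction p ¬p
cnt-any {suc N} P? {true ∷ S} p = ≤-trans (cnt-any (P? ∘ (inside ∷_)) p) (m≤m+n _ _)
cnt-any {suc N} P? {false ∷ S} p = ≤-trans (cnt-any (P? ∘ (outside ∷_)) p) (m≤n+m _ _)

cnt-∃ : ∀ {N} {P : U.Pred (Subset N) 0ℓ} (P? : U.Decidable P) → 1 ≤ cnt P? → ∃ P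
cnt-∃ P? h with anySubset? P?
... | yes e = e
... | no ¬e = contradiction (cnt-none P? (¬e ∘ (_ ,_))) (>⇒≢ h)

cnt-split : ∀ {N} {P Q : U.Pred (Subset N) 0ℓ} (P? : U.Decidable P) (Q? : U.Decidable Q) →
  cnt P? ≤ cnt (P? ∩? Q?) + cnt (P? ∩? ∁? Q?)
cnt-split {P = P} {Q} P? Q? = cnt-cover P? (P? ∩? Q?) (P? ∩? ∁? Q?) split
  where
  split : ∀ {S} → P S → (P U.∩ Q) S ⊎ (P U.∩ U.∁ Q) S
  split {S} p with Q? S
  ... | yes q = inj₁ (p , q)
  ... | no ¬q = inj₂ (p , ¬q)

∀⊎∃ : ∀ {N} {P Q : U.Pred (Subset N) 0ℓ} → U.Decidable P → U.Decidable Q →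
  (∀ {S} → P S → Q S) ⊎ ∃[ S ] (P S × ¬ Q S)
∀⊎∃ P? Q? with anySubset? (P? ∩? ∁? Q?)
... | yes e = inj₂ e
... | no ¬e = inj₁ λ {S} p → decidable-stable (Q? S) (λ ¬q → ¬e (S , p , ¬q))

-- Intersecting sets and the union bound.

Meets : ∀ {N} → Subset N → U.Pred (Subset N) 0ℓ
Meets A S = Nonempty (A ∩ S)

meets? : ∀ {N} (A : Subset N) → U.Decidable (Meets A)
meets? A S = nonempty? (A ∩ S)

meets : ∀ {N} {A S : Subset N} {x} → x ∈ A → x ∈ S → Meets A S
meets a s = _ , x∈p∩q⁺ (a , s)

meets⁻ : ∀ {N} {A S : Subset N} → Meets A S → ∃[ x ] (x ∈ A × x ∈ S)
meets⁻ {A = A} {S} (x , x∈) = x , x∈p∩q⁻ A S x∈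

has? : ∀ {N} (x : Fin N) → U.Decidable (x ∈_)
has? x S = x ∈? S

-- Split off the sets through one point of `A`; the remaining ones meet `A` without that point.
cnt-union : ∀ {N} {P : U.Pred (Subset N) 0ℓ} (P? : U.Decidable P) (A : Subset N) {M a} →
  ∣ A ∣ ≤ a → (∀ {S} → P S → Meets A S) → (∀ {x} → x ∈ A → cnt (P? ∩? has? x) ≤ M) →
  cnt P? ≤ a * M
cnt-union {P = P} P? A {M} ∣A∣≤a m d with nonempty? A
... | no ¬ne = ≤-trans (≤-reflexive (cnt-none P? none)) z≤n
  where
  none : ∀ {S} → ¬ P S
  none p = let (x , x∈A , _) = meets⁻ (m p) in ¬ne (x , x∈A)
cnt-union {P = P} P? A {M} {zero} ∣A∣≤a m d | yes (x , x∈A) =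
  contradiction (≤-trans (x∈p⇒∣p-x∣<∣p∣ x∈A) ∣A∣≤a) λ ()
cnt-union {P = P} P? A {M} {suc a} ∣A∣≤a m d | yes (x , x∈A) = begin
  cnt P?                                          ≤⟨ cnt-split P? (has? x) ⟩
  cnt (P? ∩? has? x) + cnt (P? ∩? ∁? (has? x))    ≤⟨ +-mono-≤ (d x∈A) rest ⟩
  M + a * M                                       ∎
  where
  open ≤-Reasoning
  m′ : ∀ {S} → (P U.∩ U.∁ (x ∈_)) S → Meets (A - x) S
  m′ (p , x∉S) with meets⁻ (m p)
  ... | y , y∈A , y∈S = meets (x∈p∧x≢y⇒x∈p-y y∈A λ { refl → x∉S y∈S }) y∈S
  rest : cnt (P? ∩? ∁? (has? x)) ≤ a * M
  rest = cnt-union (P? ∩? ∁? (has? x)) (A - x)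
    (s≤s⁻¹ (≤-trans (x∈p⇒∣p-x∣<∣p∣ x∈A) ∣A∣≤a)) m′
    (λ {y} y∈ → ≤-trans
      (cnt-mono ((P? ∩? ∁? (has? x)) ∩? has? y) (P? ∩? has? y) (λ ((p , _) , y∈S) → p , y∈S))
      (d (p─q⊆p A ⁅ x ⁆ y∈)))

length≤cnt : ∀ {N} {P : U.Pred (Subset N) 0ℓ} (P? : U.Decidable P) {xs : List (Subset N)} →
  Unique xs → All P xs → length xs ≤ cnt P?
length≤cnt P? [] [] = z≤n
length≤cnt {P = P} P? {x ∷ xs} (x∉ ∷ u) (p ∷ ps) = begin
  1 + length xs                                           ≤⟨ +-mono-≤
    (cnt-any (P? ∩? (_≟S x)) {x} (p , refl))
    (length≤cnt (P? ∩? ∁? (_≟S x)) u (All.zip (ps , All.map (λ x≢y y≡x → x≢y (sym y≡x)) x∉))) ⟩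
  cnt (P? ∩? (_≟S x)) + cnt (P? ∩? ∁? (_≟S x))            ≤⟨
    cnt-disjoint P? (P? ∩? (_≟S x)) (P? ∩? ∁? (_≟S x)) proj₁ proj₁ (λ q r → proj₂ r (proj₂ q)) ⟩
  cnt P?                                                  ∎
  where
  open ≤-Reasoning
  _≟S_ : (A B : Subset _) → Dec (A ≡ B)
  _≟S_ = Vec.≡-dec Bool._≟_

-- Binomial coefficients with prescribed points.

-- bin r x k is the binomial coefficient "r choose k - x", and 0 if k < x: the
-- number of k-sets containing a given x-set whose complement has r elements.
bin : ℕ → ℕ → ℕ → ℕ
bin r zero k = r C k
bin r (suc x) zero = 0
bin r (suc x) (suc k) = bin r x k

pascal : ∀ r x k → bin (suc r) x k ≡ bin r x k + bin r (suc x) k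
pascal r zero zero = refl
pascal r zero (suc k) = trans (sym (nCk+nC[k+1]≡[n+1]C[k+1] r k)) (+-comm (r C k) _)
pascal r (suc x) zero = refl
pascal r (suc x) (suc k) = pascal r x k

bin-suc : ∀ r x k → bin r x k ≤ bin (suc r) x k
bin-suc r x k = ≤-trans (m≤m+n _ _) (≤-reflexive (sym (pascal r x k)))

bin-mono : ∀ {r r′} x k → r ≤ r′ → bin r x k ≤ bin r′ x k
bin-mono x k r≤r′ = go (≤⇒≤′ r≤r′)
  where
  go : ∀ {r r′} → r ≤′ r′ → bin r x k ≤ bin r′ x k
  go ≤′-refl = ≤-refl
  go (≤′-step p) = ≤-trans (go p) (bin-suc _ x k)

bin-shift : ∀ r x k → bin r (suc x) k ≤ bin (suc r) x k
bin-shift r x k = ≤-trans (m≤n+m _ (bin r x k)) (≤-reflexive (sym (pascal r x k)))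

bin-self : ∀ r x → bin r x x ≡ 1
bin-self r zero = refl
bin-self r (suc x) = bin-self r x

bin-< : ∀ r {x k} → k < x → bin r x k ≡ 0
bin-< r {suc x} {zero} _ = refl
bin-< r {suc x} {suc k} (s≤s p) = bin-< r p

-- Counting sets that contain given points or meet a given cover.

Between : ∀ {N} → Subset N → Subset N → ℕ → U.Pred (Subset N) 0ℓ
Between X V k S = X ⊆ S × S ⊆ V × ∣ S ∣ ≡ k

between? : ∀ {N} (X V : Subset N) k → U.Decidable (Between X V k)
between? X V k S = (X ⊆? S) ×-dec (S ⊆? V) ×-dec (∣ S ∣ ≟ k)

in∉out : ∀ {N} {S : Subset N} → Fin.zero ∉ outside ∷ S
in∉out ()

-- Recursion over the points: a point of `X` is forced, a point outside `V` is forbidden, and any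
-- other point leaves both options, which is `pascal`.
cnt-between : ∀ {N} (X V : Subset N) k {r} → X ⊆ V → ∣ V ∣ ≡ r + ∣ X ∣ →
  cnt (between? X V k) ≡ bin r ∣ X ∣ k
cnt-between [] [] k {zero} _ _ with [] {A = Bool.Bool} ⊆? [] | k
... | yes _ | zero  = refl
... | yes _ | suc _ = refl
... | no ⊈ | _ = contradiction (λ {x} → ⊆-refl {x = []} {x}) ⊈
cnt-between [] [] k {suc r} _ ()
cnt-between (true ∷ X) (false ∷ V) k X⊆V _ = contradiction (X⊆V here) in∉out
cnt-between (true ∷ X) (true ∷ V) zero X⊆V eq = cong₂ _+_
  (cnt-none (between? (inside ∷ X) (inside ∷ V) 0 ∘ (inside ∷_)) λ { (_ , _ , ()) })
  (cnt-none (between? (inside ∷ X) (inside ∷ V) 0 ∘ (outside ∷_)) λ { (f , _) → in∉out (f here) })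
cnt-between (true ∷ X) (true ∷ V) (suc k) {r} X⊆V eq = begin
  cnt (B ∘ (inside ∷_)) + cnt (B ∘ (outside ∷_))
    ≡⟨ cong₂ _+_
         (cnt-cong (B ∘ (inside ∷_)) (between? X V k)
           (λ { (f , g , h) → drop-∷-⊆ f , drop-∷-⊆ g , suc-injective h })
           (λ { (f , g , h) → in⊆in f , in⊆in g , cong suc h }))
         (cnt-none (B ∘ (outside ∷_)) λ { (f , _) → in∉out (f here) }) ⟩
  cnt (between? X V k) + 0
    ≡⟨ +-identityʳ _ ⟩
  cnt (between? X V k)
    ≡⟨ cnt-between X V k (drop-∷-⊆ X⊆V) (suc-injective (trans eq (+-suc r ∣ X ∣))) ⟩
  bin r ∣ X ∣ k ∎
  where
  open ≡-Reasoning
  B = between? (inside ∷ X) (inside ∷ V) (suc k)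
cnt-between (false ∷ X) (true ∷ V) k {zero} X⊆V eq =
  contradiction (p⊆q⇒∣p∣≤∣q∣ (drop-∷-⊆ X⊆V)) (<⇒≱ (≤-reflexive eq))
cnt-between (false ∷ X) (true ∷ V) k {suc r} X⊆V eq = begin
  cnt (B k ∘ (inside ∷_)) + cnt (B k ∘ (outside ∷_))
    ≡⟨ cong₂ _+_ (inner k)
         (trans (cnt-cong (B k ∘ (outside ∷_)) (between? X V k)
           (λ { (f , g , h) → drop-∷-⊆ f , drop-∷-⊆ g , h })
           (λ { (f , g , h) → out⊆ f , out⊆ g , h }))
           (cnt-between X V k (drop-∷-⊆ X⊆V) eq′)) ⟩
  bin r (suc (∣ X ∣)) k + bin r (∣ X ∣) k
    ≡⟨ +-comm (bin r (suc (∣ X ∣)) k) _ ⟩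
  bin r (∣ X ∣) k + bin r (suc (∣ X ∣)) k
    ≡⟨ pascal r (∣ X ∣) k ⟨
  bin (suc r) (∣ X ∣) k ∎
  where
  open ≡-Reasoning
  B = λ k → between? (outside ∷ X) (inside ∷ V) k
  eq′ : ∣ V ∣ ≡ r + ∣ X ∣
  eq′ = suc-injective eq
  inner : ∀ k → cnt (B k ∘ (inside ∷_)) ≡ bin r (suc ∣ X ∣) k
  inner zero = cnt-none (B 0 ∘ (inside ∷_)) λ { (_ , _ , ()) }
  inner (suc k) = trans (cnt-cong (B (suc k) ∘ (inside ∷_)) (between? X V k)
    (λ { (f , g , h) → drop-∷-⊆ f , drop-∷-⊆ g , suc-injective h })
    (λ { (f , g , h) → out⊆ f , in⊆in g , cong suc h }))
    (cnt-between X V k (drop-∷-⊆ X⊆V) eq′)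
cnt-between (false ∷ X) (false ∷ V) k {r} X⊆V eq = begin
  cnt (B ∘ (inside ∷_)) + cnt (B ∘ (outside ∷_))
    ≡⟨ cong₂ _+_
         (cnt-none (B ∘ (inside ∷_)) λ { (_ , g , _) → in∉out (g here) })
         (cnt-cong (B ∘ (outside ∷_)) (between? X V k)
           (λ { (f , g , h) → drop-∷-⊆ f , drop-∷-⊆ g , h })
           (λ { (f , g , h) → out⊆ f , out⊆ g , h })) ⟩
  cnt (between? X V k)
    ≡⟨ cnt-between X V k (drop-∷-⊆ X⊆V) eq ⟩
  bin r ∣ X ∣ k ∎
  where
  open ≡-Reasoning
  B = between? (outside ∷ X) (outside ∷ V) k

∣p∣≡∣p─q∣+∣q∣ : ∀ {N} (p q : Subset N) → q ⊆ p → ∣ p ∣ ≡ ∣ p ─ q ∣ + ∣ q ∣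
∣p∣≡∣p─q∣+∣q∣ [] [] _ = refl
∣p∣≡∣p─q∣+∣q∣ (true ∷ p) (true ∷ q) h = trans (cong suc (∣p∣≡∣p─q∣+∣q∣ p q (drop-∷-⊆ h)))
  (sym (+-suc _ ∣ q ∣))
∣p∣≡∣p─q∣+∣q∣ (true ∷ p) (false ∷ q) h = cong suc (∣p∣≡∣p─q∣+∣q∣ p q (drop-∷-⊆ h))
∣p∣≡∣p─q∣+∣q∣ (false ∷ p) (true ∷ q) h = contradiction (h here) in∉out
∣p∣≡∣p─q∣+∣q∣ (false ∷ p) (false ∷ q) h = ∣p∣≡∣p─q∣+∣q∣ p q (drop-∷-⊆ h)

∣p∪q∣≤∣p∣+∣q∣ : ∀ {N} (p q : Subset N) → ∣ p ∪ q ∣ ≤ ∣ p ∣ + ∣ q ∣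
∣p∪q∣≤∣p∣+∣q∣ [] [] = z≤n
∣p∪q∣≤∣p∣+∣q∣ (true ∷ p) (true ∷ q) = s≤s (≤-trans (∣p∪q∣≤∣p∣+∣q∣ p q) (+-monoʳ-≤ ∣ p ∣ (n≤1+n _)))
∣p∪q∣≤∣p∣+∣q∣ (true ∷ p) (false ∷ q) = s≤s (∣p∪q∣≤∣p∣+∣q∣ p q)
∣p∪q∣≤∣p∣+∣q∣ (false ∷ p) (true ∷ q) = ≤-trans (s≤s (∣p∪q∣≤∣p∣+∣q∣ p q)) (≤-reflexive (sym (+-suc ∣ p ∣ _)))
∣p∪q∣≤∣p∣+∣q∣ (false ∷ p) (false ∷ q) = ∣p∪q∣≤∣p∣+∣q∣ p q

∣⁅x⁆∪p∣ : ∀ {N} {x : Fin N} {p} → x ∉ p → ∣ ⁅ x ⁆ ∪ p ∣ ≡ suc ∣ p ∣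
∣⁅x⁆∪p∣ {x = zero} {true ∷ p} x∉p = contradiction here x∉p
∣⁅x⁆∪p∣ {x = zero} {false ∷ p} x∉p = cong (suc ∘ ∣_∣) (∪-identityˡ p)
∣⁅x⁆∪p∣ {x = suc x} {true ∷ p} x∉p = cong suc (∣⁅x⁆∪p∣ (drop-not-there x∉p))
∣⁅x⁆∪p∣ {x = suc x} {false ∷ p} x∉p = ∣⁅x⁆∪p∣ (drop-not-there x∉p)

∪-⊆ : ∀ {N} {p q r : Subset N} → p ⊆ r → q ⊆ r → p ∪ q ⊆ r
∪-⊆ {p = p} {q} f g x∈ with x∈p∪q⁻ p q x∈
... | inj₁ x∈p = f x∈p
... | inj₂ x∈q = g x∈q

⁅x⁆⊆ : ∀ {N} {x : Fin N} {p} → x ∈ p → ⁅ x ⁆ ⊆ p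
⁅x⁆⊆ {x = x} x∈p y∈ with refl ← x∈⁅y⁆⇒x≡y x y∈ = x∈p

x∈p─q⁻ : ∀ {N} {x : Fin N} (p q : Subset N) → x ∈ p ─ q → x ∈ p × x ∉ q
x∈p─q⁻ (true ∷ p) (false ∷ q) here = here , λ ()
x∈p─q⁻ {x = zero} (false ∷ p) (true ∷ q) ()
x∈p─q⁻ {x = zero} (false ∷ p) (false ∷ q) ()
x∈p─q⁻ {x = zero} (true ∷ p) (true ∷ q) ()
x∈p─q⁻ (s ∷ p) (t ∷ q) (there h) = let (a , b) = x∈p─q⁻ p q h in there a , b ∘ drop-there

⊆─ : ∀ {N} {S p q : Subset N} → S ⊆ p → ¬ Meets q S → S ⊆ p ─ q
⊆─ S⊆p ¬m x∈S = x∈p∧x∉q⇒x∈p─q (S⊆p x∈S) (λ x∈q → ¬m (meets x∈q x∈S))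

⊆─⇒¬Meets : ∀ {N} {S : Subset N} p q → S ⊆ p ─ q → ¬ Meets q S
⊆─⇒¬Meets p q S⊆ m = let (x , x∈q , x∈S) = meets⁻ m in proj₂ (x∈p─q⁻ p q (S⊆ x∈S)) x∈q

Uniform : ∀ {N} → Subset N → ℕ → U.Pred (Subset N) 0ℓ → Set
Uniform V k P = ∀ {S} → P S → S ⊆ V × ∣ S ∣ ≡ k

cnt-interval : ∀ {N} (X V : Subset N) k {x r} → X ⊆ V → ∣ X ∣ ≡ x → ∣ V ∣ ≡ r + x →
  cnt (between? X V k) ≡ bin r x k
cnt-interval X V k X⊆V refl eq = cnt-between X V k X⊆V eq

cnt-all : ∀ {N} (V : Subset N) k → cnt (between? ∅ V k) ≡ ∣ V ∣ C k
cnt-all {N} V k = cnt-interval ∅ V k (⊆-min V) (∣⊥∣≡0 N) (sym (+-identityʳ _))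

cnt-star : ∀ {N} {P : U.Pred (Subset N) 0ℓ} (P? : U.Decidable P) {X V : Subset N} {k x r} →
  Uniform V k P → X ⊆ V → ∣ X ∣ ≡ x → ∣ V ∣ ≡ r + x → (∀ {S} → P S → X ⊆ S) →
  cnt P? ≤ bin r x k
cnt-star P? {X} {V} {k} U X⊆V ∣X∣ ∣V∣ h = ≤-trans
  (cnt-mono P? (between? X V k) (λ p → h p , U p))
  (≤-reflexive (cnt-interval X V k X⊆V ∣X∣ ∣V∣))

∣p─q∣ : ∀ {N} {p q : Subset N} {r c} → q ⊆ p → ∣ q ∣ ≡ c → ∣ p ∣ ≡ r + c → ∣ p ─ q ∣ ≡ r
∣p─q∣ {p = p} {q} {r} q⊆p refl eq = +-cancelʳ-≡ _ _ _ (trans (sym (∣p∣≡∣p─q∣+∣q∣ p q q⊆p)) eq)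

-- The `k`-sets inside `V ─ W` miss `W`, so none of them is counted by `P?`.
cnt-cover-bound : ∀ {N} {P : U.Pred (Subset N) 0ℓ} (P? : U.Decidable P) {V W : Subset N} {k r w} →
  Uniform V k P → W ⊆ V → ∣ W ∣ ≡ w → ∣ V ∣ ≡ r + w → (∀ {S} → P S → Meets W S) →
  cnt P? + r C k ≤ (r + w) C k
cnt-cover-bound P? {V} {W} {k} {r} {w} U W⊆V ∣W∣ ∣V∣ h = begin
  cnt P? + r C k
    ≡⟨ cong (λ z → cnt P? + z C k) (∣p─q∣ W⊆V ∣W∣ ∣V∣) ⟨
  cnt P? + ∣ V ─ W ∣ C k
    ≡⟨ cong (cnt P? +_) (cnt-all (V ─ W) k) ⟨
  cnt P? + cnt (between? ∅ (V ─ W) k)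
    ≤⟨ cnt-disjoint (between? ∅ V k) P? (between? ∅ (V ─ W) k)
         (λ p → ⊆-min _ , U p)
         (λ (_ , f , g) → ⊆-min _ , p─q⊆p V W ∘ f , g)
         (λ p (_ , f , _) → ⊆─⇒¬Meets V W f (h p)) ⟩
  cnt (between? ∅ V k)
    ≡⟨ cnt-all V k ⟩
  ∣ V ∣ C k
    ≡⟨ cong (_C k) ∣V∣ ⟩
  (r + w) C k ∎
  where
  open ≤-Reasoning

cnt-star-cover : ∀ {N} {P : U.Pred (Subset N) 0ℓ} (P? : U.Decidable P)
  {V B : Subset N} {x : Fin N} {k r b} →
  Uniform V k P → x ∈ V → B ⊆ V → x ∉ B → ∣ B ∣ ≡ b → ∣ V ∣ ≡ r + 1 + b →
  (∀ {S} → P S → x ∈ S) → (∀ {S} → P S → Meets B S) →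
  cnt P? + bin r 1 k ≤ bin (r + b) 1 k
cnt-star-cover P? {V} {B} {x} {k} {r} {b} U x∈V B⊆V x∉B ∣B∣ ∣V∣ h m = begin
  cnt P? + bin r 1 k
    ≡⟨ cong (cnt P? +_) (cnt-interval ⁅ x ⁆ (V ─ B) k (⁅x⁆⊆ (x∈p∧x∉q⇒x∈p─q x∈V x∉B))
         (∣⁅x⁆∣≡1 x) (∣p─q∣ B⊆V ∣B∣ ∣V∣)) ⟨
  cnt P? + cnt (between? ⁅ x ⁆ (V ─ B) k)
    ≤⟨ cnt-disjoint (between? ⁅ x ⁆ V k) P? (between? ⁅ x ⁆ (V ─ B) k)
         (λ p → ⁅x⁆⊆ (h p) , U p)
         (λ (e , f , g) → e , p─q⊆p V B ∘ f , g)
         (λ p (_ , f , _) → ⊆─⇒¬Meets V B f (m p)) ⟩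
  cnt (between? ⁅ x ⁆ V k)
    ≡⟨ cnt-interval ⁅ x ⁆ V k (⁅x⁆⊆ x∈V) (∣⁅x⁆∣≡1 x) (trans ∣V∣ (rearr r b)) ⟩
  bin (r + b) 1 k ∎
  where
  open ≤-Reasoning
  rearr : ∀ r b → r + 1 + b ≡ r + b + 1
  rearr = solve-∀

tabulate⁺ : ∀ {N} {D : U.Pred (Fin N) 0ℓ} (D? : U.Decidable D) {x} → D x → x ∈ tabulate (does ∘ D?)
tabulate⁺ D? {x} d = Vec.lookup⇒[]= x _
  (trans (Vec.lookup∘tabulate (does ∘ D?) x) (dec-true (D? x) d))

tabulate⁻ : ∀ {N} {D : U.Pred (Fin N) 0ℓ} (D? : U.Decidable D) {x} → x ∈ tabulate (does ∘ D?) → D x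
tabulate⁻ D? {x} x∈ with D? x | trans (sym (Vec.lookup∘tabulate (does ∘ D?) x)) (Vec.[]=⇒lookup x∈)
... | yes d | _ = d
... | no _ | ()

-- Estimates for binomial coefficients.

C-absorb : ∀ r j → suc j * (suc r C suc j) ≡ suc r * (r C j)
C-absorb zero zero = refl
C-absorb zero (suc j) = trans (cong (suc (suc j) *_) (k>n⇒nCk≡0 {1} {suc (suc j)} (s≤s (s≤s z≤n))))
  (trans (*-zeroʳ (suc (suc j))) (sym (trans (*-identityˡ (0 C suc j)) (k>n⇒nCk≡0 {0} {suc j} (s≤s z≤n)))))
C-absorb (suc r) zero = trans (*-identityˡ _) (trans (nC1≡n (suc (suc r))) (sym (*-identityʳ _)))
C-absorb (suc r) (suc j) = begin
  suc (suc j) * (suc (suc r) C suc (suc j))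
    ≡⟨ cong (suc (suc j) *_) (nCk+nC[k+1]≡[n+1]C[k+1] (suc r) (suc j)) ⟨
  suc (suc j) * (a + b)
    ≡⟨ distr j a b ⟩
  (suc j * a + a) + suc (suc j) * b
    ≡⟨ cong₂ (λ y z → (y + a) + z) (C-absorb r j) (C-absorb r (suc j)) ⟩
  (suc r * c + a) + suc r * d
    ≡⟨ collect (suc r) a c d ⟩
  suc r * (c + d) + a
    ≡⟨ cong (λ z → suc r * z + a) (nCk+nC[k+1]≡[n+1]C[k+1] r j) ⟩
  suc r * a + a
    ≡⟨ +-comm (suc r * a) a ⟩
  suc (suc r) * a ∎
  where
  open ≡-Reasoning
  a = suc r C suc j
  b = suc r C suc (suc j)
  c = r C j
  d = r C suc j
  distr : ∀ j a b → suc (suc j) * (a + b) ≡ (suc j * a + a) + suc (suc j) * b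
  distr = solve-∀
  collect : ∀ r a c d → (r * c + a) + r * d ≡ r * (c + d) + a
  collect = solve-∀

bin-absorb : ∀ r x j → j * bin (suc r) x (x + j) ≡ suc r * bin r (suc x) (x + j)
bin-absorb r zero zero = sym (*-zeroʳ (suc r))
bin-absorb r zero (suc j) = C-absorb r j
bin-absorb r (suc x) j = bin-absorb r x j

-- By `bin-absorb` the two coefficients are in the ratio `suc r` to `j`. This is how a lower bound
-- on n makes sets through one more point rarer by the factor `c`.
bin-ratio : ∀ r x j c → c * j ≤ suc r → c * bin r (suc x) (x + j) ≤ bin (suc r) x (x + j)
bin-ratio r x zero c _ = ≤-trans (≤-reflexive (trans
  (cong (c *_) (bin-< r {suc x} {x + 0} (s≤s (≤-reflexive (+-identityʳ x))))) (*-zeroʳ c))) z≤n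
bin-ratio r x (suc j) c h = *-cancelˡ-≤ (suc j) (begin
  suc j * (c * y)       ≡⟨ swap (suc j) c y ⟩
  (c * suc j) * y       ≤⟨ *-monoˡ-≤ y h ⟩
  suc r * y             ≡⟨ bin-absorb r x (suc j) ⟨
  suc j * bin (suc r) x (x + suc j) ∎)
  where
  open ≤-Reasoning
  y = bin r (suc x) (x + suc j)
  swap : ∀ j c y → j * (c * y) ≡ (c * j) * y
  swap = solve-∀

bin-anti : ∀ k {r r₀ c c₀} → c₀ ≤ c → r + c ≡ r₀ + c₀ → bin r c k ≤ bin r₀ c₀ k
bin-anti k {r} {r₀} {c} {c₀} c₀≤c eq = go (≤⇒≤′ c₀≤c) eq
  where
  go : ∀ {r c} → c₀ ≤′ c → r + c ≡ r₀ + c₀ → bin r c k ≤ bin r₀ c₀ k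
  go ≤′-refl eq rewrite +-cancelʳ-≡ c₀ _ _ eq = ≤-refl
  go {r} {suc c} (≤′-step p) eq = ≤-trans (bin-shift r c k) (go p (trans (sym (+-suc r c)) eq))

-- The binomial coefficient "a choose 2".
tri : ℕ → ℕ
tri zero = 0
tri (suc a) = a + tri a

2tri+a≡a*a : ∀ a → (tri a + tri a) + a ≡ a * a
2tri+a≡a*a zero = refl
2tri+a≡a*a (suc a) = trans (expand a (tri a))
  (trans (cong (λ z → suc (z + (a + a))) (2tri+a≡a*a a)) (square a))
  where
  expand : ∀ a t → ((a + t) + (a + t)) + suc a ≡ suc (((t + t) + a) + (a + a))
  expand = solve-∀
  square : ∀ a → suc (a * a + (a + a)) ≡ suc a * suc a
  square = solve-∀

tri+a≤a*a : ∀ a → tri a + a ≤ a * a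
tri+a≤a*a a = ≤-trans (+-monoˡ-≤ a (m≤m+n (tri a) (tri a))) (≤-reflexive (2tri+a≡a*a a))

bin-increment : ∀ x k r l {R} → r + l ≤ suc R → bin (r + l) x k ≤ bin r x k + l * bin R (suc x) k
bin-increment x k r zero h rewrite +-identityʳ r = m≤m+n _ _
bin-increment x k r (suc l) {R} h rewrite +-suc r l = begin
  bin (suc (r + l)) x k
    ≡⟨ pascal (r + l) x k ⟩
  bin (r + l) x k + bin (r + l) (suc x) k
    ≤⟨ +-mono-≤ (bin-increment x k r l (≤-trans (n≤1+n _) h)) (bin-mono (suc x) k (s≤s⁻¹ h)) ⟩
  (bin r x k + l * E) + E
    ≡⟨ rearr (bin r x k) (l * E) E ⟩
  bin r x k + suc l * E ∎
  where
  open ≤-Reasoning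
  E = bin R (suc x) k
  rearr : ∀ a b c → (a + b) + c ≡ a + (c + b)
  rearr = solve-∀

-- A Bonferroni inequality of second order. By Pascal's rule, `bin (suc (suc R)) x k` minus
-- `bin r x k` is a sum of `a` coefficients; the i-th falls short of `bin (suc R) (suc x) k` by at
-- most i - 1 times the last coefficient, which adds up to `tri a`.
bin-taylor : ∀ x k r a {R} → r + a ≡ suc (suc R) →
  bin r x k + a * bin (suc R) (suc x) k ≤ bin (suc (suc R)) x k + tri a * bin R (suc (suc x)) k
bin-taylor x k r zero eq rewrite trans (sym (+-identityʳ r)) eq = ≤-refl
bin-taylor x k r (suc a) {R} eq = begin
  B + (u + a * u)
    ≤⟨ +-monoʳ-≤ B (+-monoˡ-≤ (a * u) u≤) ⟩
  B + ((B′ + a * e) + a * u)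
    ≡⟨ rearr B B′ (a * e) (a * u) ⟩
  ((B + B′) + a * u) + a * e
    ≡⟨ cong (λ z → (z + a * u) + a * e) (pascal r x k) ⟨
  (bin (suc r) x k + a * u) + a * e
    ≤⟨ +-monoˡ-≤ (a * e) (bin-taylor x k (suc r) a (trans (sym (+-suc r a)) eq)) ⟩
  (T + tri a * e) + a * e
    ≡⟨ collect T (tri a) a e ⟩
  T + (a + tri a) * e ∎
  where
  open ≤-Reasoning
  B = bin r x k
  B′ = bin r (suc x) k
  u = bin (suc R) (suc x) k
  e = bin R (suc (suc x)) k
  T = bin (suc (suc R)) x k
  r+a : r + a ≡ suc R
  r+a = suc-injective (trans (sym (+-suc r a)) eq)
  u≤ : u ≤ B′ + a * e
  u≤ = subst (λ z → bin z (suc x) k ≤ B′ + a * e) r+a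
    (bin-increment (suc x) k r a (≤-reflexive r+a))
  rearr : ∀ a b c d → a + ((b + c) + d) ≡ ((a + b) + d) + c
  rearr = solve-∀
  collect : ∀ T t a e → (T + t * e) + a * e ≡ T + (a + t) * e
  collect = solve-∀

module _ {N} {P : U.Pred (Subset N) 0ℓ} (P? : U.Decidable P) {V : Subset N} {k : ℕ} where

  cnt-star₁ : ∀ {x r} → Uniform V k P → x ∈ V → ∣ V ∣ ≡ r + 1 → (∀ {S} → P S → x ∈ S) →
    cnt P? ≤ bin r 1 k
  cnt-star₁ {x} U x∈V ∣V∣ hx = cnt-star P? U (⁅x⁆⊆ x∈V) (∣⁅x⁆∣≡1 x) ∣V∣ (⁅x⁆⊆ ∘ hx)

  cnt-star₂ : ∀ {x y r} → Uniform V k P → x ∈ V → y ∈ V → x ≢ y → ∣ V ∣ ≡ r + 2 →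
    (∀ {S} → P S → x ∈ S) → (∀ {S} → P S → y ∈ S) → cnt P? ≤ bin r 2 k
  cnt-star₂ {x} {y} U x∈V y∈V x≢y ∣V∣ hx hy = cnt-star P? U (∪-⊆ (⁅x⁆⊆ x∈V) (⁅x⁆⊆ y∈V))
    (trans (∣⁅x⁆∪p∣ (x≢y⇒x∉⁅y⁆ x≢y)) (cong suc (∣⁅x⁆∣≡1 y))) ∣V∣
    (λ p → ∪-⊆ (⁅x⁆⊆ (hx p)) (⁅x⁆⊆ (hy p)))

  cnt-star₃ : ∀ {x y z r} → Uniform V k P → x ∈ V → y ∈ V → z ∈ V →
    x ≢ y → x ≢ z → y ≢ z → ∣ V ∣ ≡ r + 3 →
    (∀ {S} → P S → x ∈ S) → (∀ {S} → P S → y ∈ S) → (∀ {S} → P S → z ∈ S) → cnt P? ≤ bin r 3 k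
  cnt-star₃ {x} {y} {z} U x∈V y∈V z∈V x≢y x≢z y≢z ∣V∣ hx hy hz =
    cnt-star P? U (∪-⊆ (⁅x⁆⊆ x∈V) (∪-⊆ (⁅x⁆⊆ y∈V) (⁅x⁆⊆ z∈V)))
      (trans (∣⁅x⁆∪p∣ x∉) (cong suc (trans (∣⁅x⁆∪p∣ (x≢y⇒x∉⁅y⁆ y≢z)) (cong suc (∣⁅x⁆∣≡1 z)))))
      ∣V∣
      (λ p → ∪-⊆ (⁅x⁆⊆ (hx p)) (∪-⊆ (⁅x⁆⊆ (hy p)) (⁅x⁆⊆ (hz p))))
    where
    x∉ : x ∉ ⁅ y ⁆ ∪ ⁅ z ⁆
    x∉ x∈ with x∈p∪q⁻ ⁅ y ⁆ ⁅ z ⁆ x∈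
    ... | inj₁ x∈y = x≢y (x∈⁅y⁆⇒x≡y y x∈y)
    ... | inj₂ x∈z = x≢z (x∈⁅y⁆⇒x≡y z x∈z)

-- Arithmetic for the case t = 1.

-- Moving terms across an inequality, so that the ring solver can check the rest.
linear : ∀ {a b x y} s → a ≤ b → x + b + s ≡ y + a → x ≤ y
linear {a} {b} {x} {y} s a≤b eq = +-cancelʳ-≤ b x y (≤-trans (m≤m+n (x + b) s)
  (≤-trans (≤-reflexive eq) (+-monoʳ-≤ y a≤b)))

m≤m*m : ∀ m → m ≤ m * m
m≤m*m zero = z≤n
m≤m*m (suc m) = m≤m*n (suc m) (suc m)

-- Here and below l is the size of the sets of the other family, and u and e are the
-- numbers of k-sets through two and through three given points.
excess-absurd : ∀ l u e q → l * l * e + l * l * e ≤ u →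
  ¬ (suc q * u + 2 ≤ suc q * (l * e) + (tri l + l) * e)
excess-absurd l u e q y+y≤u h = contradiction bad λ ()
  where
  y = l * l * e
  a₁ : (tri l + l) * e ≤ y
  a₁ = *-monoˡ-≤ e (tri+a≤a*a l)
  a₂ : suc q * (l * e) ≤ suc q * y
  a₂ = *-monoʳ-≤ (suc q) (*-monoˡ-≤ e (m≤m*m l))
  a₃ : suc q * (y + y) ≤ suc q * u
  a₃ = *-monoʳ-≤ (suc q) y+y≤u
  ring : ∀ q u y z w → 2 + (((suc q * (z) + w) + (y + suc q * y)) + suc q * u) + q * y ≡
    0 + (((suc q * u + 2) + (w + suc q * z)) + suc q * (y + y))
  ring = solve-∀
  bad : 2 ≤ 0
  bad = linear (q * y) (+-mono-≤ (+-mono-≤ h (+-mono-≤ a₁ a₂)) a₃)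
    (ring q u y (l * e) ((tri l + l) * e))

-- Here `f` is the size of the family, `fx` and `fy` count its members through and avoiding a point,
-- `c` is the size of the core and `suc q` what it lacks to `l`. The upper bound on `fx` leaves
-- `suc q * u`, up to terms in `e`, for `fy`.
excess : ∀ {l c q u e f fx fy} → c + suc q ≡ l →
  l * u + 2 ≤ f + tri l * e → f ≤ fx + fy → fx ≤ c * u + suc q * (l * e) →
  suc q * u + 2 ≤ fy + (suc q * (l * e) + tri l * e)
excess {c = c} {q} {u} {e} {f} {fx} {fy} refl h₁ h₂ h₃ =
  linear 0 (+-mono-≤ (+-mono-≤ h₁ h₂) h₃) (ring c q u f fx fy (tri (c + suc q) * e) ((c + suc q) * e))
  where
  ring : ∀ c q u f fx fy t z →
    (suc q * u + 2) + (((f + t) + (fx + fy)) + (c * u + suc q * z)) + 0 ≡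
    (fy + (suc q * z + t)) + ((((c + suc q) * u + 2) + f) + fx)
  ring = solve-∀

excess-large : ∀ {l c q u e f fx fy} → c + suc q ≡ l → l * l * e + l * l * e ≤ u →
  l * u + 2 ≤ f + tri l * e → f ≤ fx + fy → fx ≤ c * u + suc q * (l * e) → l * e < fy
excess-large {l} {c} {q} {u} {e} {f} {fx} {fy} eq y+y≤u h₁ h₂ h₃ with fy ≤? l * e
... | no ≰ = ≰⇒> ≰
... | yes fy≤ = contradiction (begin
  suc q * u + 2                                ≤⟨ excess eq h₁ h₂ h₃ ⟩
  fy + (suc q * (l * e) + tri l * e)           ≤⟨ +-monoˡ-≤ _ fy≤ ⟩
  l * e + (suc q * (l * e) + tri l * e)        ≡⟨ ring q l e (tri l) ⟩
  suc q * (l * e) + (tri l + l) * e            ∎) (excess-absurd l u e q y+y≤u)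
  where
  open ≤-Reasoning
  ring : ∀ q l e t → l * e + (suc q * (l * e) + t * e) ≡ suc q * (l * e) + (t + l) * e
  ring = solve-∀

-- With `q` positive, `fy` would have to reach `2 * u` up to terms in `e`, and these are too small
-- to make up for a whole `u`.
excess-small : ∀ {l c q u e f fx fy} → c + suc q ≡ l → l * l * e + l * l * e ≤ u →
  l * u + 2 ≤ f + tri l * e → f ≤ fx + fy → fx ≤ c * u + suc q * (l * e) → fy ≤ u → q ≡ 0
excess-small {q = zero} eq y+y≤u h₁ h₂ h₃ fy≤ = refl
excess-small {l} {c} {suc q} {u} {e} {f} {fx} {fy} eq y+y≤u h₁ h₂ h₃ fy≤ =
  contradiction (linear 0 (+-mono-≤ (excess eq h₁ h₂ h₃) fy≤) (ring q u l e (tri l) fy))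
    (excess-absurd l u e q y+y≤u)
  where
  ring : ∀ q u l e t fy →
    (suc q * u + 2) + ((fy + (suc (suc q) * (l * e) + t * e)) + u) + 0 ≡
    (suc q * (l * e) + (t + l) * e) + ((suc (suc q) * u + 2) + fy)
  ring = solve-∀

-- Two points of degree `u` plus terms in `e` cannot account for `l * u` members: the `l - 2` spare
-- copies of `u` outweigh all terms in `e`.
star-absurd : ∀ {l u e f i} → 3 + i ≡ l → l * l * e + l * l * e ≤ u →
  l * u + 2 ≤ f + tri l * e → ¬ (f ≤ (u + (2 + i) * (l * e)) + (u + (2 + i) * (l * e)))
star-absurd {l} {u} {e} {f} {i} refl y+y≤u h₁ h₂ = contradiction bad λ ()
  where
  ring : ∀ i u e f t → 2 + (((f + t * e) + ((u + (2 + i) * ((3 + i) * e)) + (u + (2 + i) * ((3 + i) * e))))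
      + ((1 + i) * u + ((3 + i) * (3 + i)) * e)) + (3 + i) * (5 * i + 2 * i * i) * e ≡
    0 + ((((3 + i) * u + 2) + f) +
      ((1 + i) * ((3 + i) * (3 + i) * e + (3 + i) * (3 + i) * e) + (t + (3 + i)) * e))
  ring = solve-∀
  bad : 2 ≤ 0
  bad = linear ((3 + i) * (5 * i + 2 * i * i) * e)
    (+-mono-≤ (+-mono-≤ h₁ h₂) (+-mono-≤ (*-monoʳ-≤ (1 + i) y+y≤u) (*-monoˡ-≤ e (tri+a≤a*a l))))
    (ring i u e f (tri l))

-- `l * u` is at least twice `l * (l * (l * e))`, and `tri l * e` is too small to close the gap.
scattered-absurd : ∀ {l u e f j} → 1 + j ≡ l → l * l * e + l * l * e ≤ u →
  l * u + 2 ≤ f + tri l * e → ¬ (f ≤ l * (l * (l * e)))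
scattered-absurd {l} {u} {e} {f} {j} refl y+y≤u h₁ h₂ = contradiction bad λ ()
  where
  ring : ∀ j u e f t → 2 + (((f + t * e) + (1 + j) * ((1 + j) * ((1 + j) * e)))
      + ((1 + j) * u + ((1 + j) * (1 + j)) * e)) + (j * (1 + j) * (1 + j) + (1 + j)) * e ≡
    0 + ((((1 + j) * u + 2) + f) +
      ((1 + j) * ((1 + j) * (1 + j) * e + (1 + j) * (1 + j) * e) + (t + (1 + j)) * e))
  ring = solve-∀
  bad : 2 ≤ 0
  bad = linear ((j * (1 + j) * (1 + j) + (1 + j)) * e)
    (+-mono-≤ (+-mono-≤ h₁ h₂) (+-mono-≤ (*-monoʳ-≤ (1 + j) y+y≤u) (*-monoˡ-≤ e (tri+a≤a*a l))))
    (ring j u e f (tri l))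

-- The case t = 1: cores of cross-intersecting families.

all? : ∀ {N} {P Q : U.Pred (Subset N) 0ℓ} → U.Decidable P → U.Decidable Q →
  Dec (∀ {S} → P S → Q S)
all? P? Q? with ∀⊎∃ P? Q?
... | inj₁ h = yes h
... | inj₂ (S , p , ¬q) = no λ h → ¬q (h p)

Meets-sym : ∀ {N} {A B : Subset N} → Meets A B → Meets B A
Meets-sym m = let (x , x∈A , x∈B) = meets⁻ m in meets x∈B x∈A

-- A counterexample to the case t = 1, with n = 3 + R.  The ratios are what the lower
-- bound on n is used for.
record Cross (N : ℕ) : Set₁ where
  field
    {V}      : Subset N
    R        : ℕ
    ∣V∣≡     : ∣ V ∣ ≡ R + 3
    {k l p q} : ℕ
    p+l≡     : p + l ≡ 2 + R
    q+k≡     : q + k ≡ 2 + R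
    2≤k      : 2 ≤ k
    2≤l      : 2 ≤ l
    {F G}    : U.Pred (Subset N) 0ℓ
    F?       : U.Decidable F
    G?       : U.Decidable G
    uniformF : Uniform V k F
    uniformG : Uniform V l G
    cross    : ∀ {A B} → F A → G B → Meets A B
    nonstarF : ∀ x → ∃[ A ] (F A × x ∉ A)
    nonstarG : ∀ x → ∃[ B ] (G B × x ∉ B)
    ratioF   : l * l * bin R 3 k + l * l * bin R 3 k ≤ bin (suc R) 2 k
    ratioG   : k * k * bin R 3 l + k * k * bin R 3 l ≤ bin (suc R) 2 l
    sizeF    : bin (2 + R) 1 k + 2 ≤ cnt F? + bin p 1 k
    sizeG    : bin (2 + R) 1 l + 2 ≤ cnt G? + bin q 1 l

  F∋ G∋ F∌ G∌ : Fin N → U.Pred (Subset N) 0ℓ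
  F∋ x = F U.∩ (x ∈_)
  G∋ x = G U.∩ (x ∈_)
  F∌ x = F U.∩ U.∁ (x ∈_)
  G∌ x = G U.∩ U.∁ (x ∈_)

  F∋? : ∀ x → U.Decidable (F∋ x)
  F∋? x = F? ∩? has? x
  G∋? : ∀ x → U.Decidable (G∋ x)
  G∋? x = G? ∩? has? x
  F∌? : ∀ x → U.Decidable (F∌ x)
  F∌? x = F? ∩? ∁? (has? x)
  G∌? : ∀ x → U.Decidable (G∌ x)
  G∌? x = G? ∩? ∁? (has? x)

  u e : ℕ
  u = bin (suc R) 2 k
  e = bin R 3 k

  ∣V∣≡′ : ∣ V ∣ ≡ suc R + 2
  ∣V∣≡′ = trans ∣V∣≡ (+-suc R 2)

  sizeF′ : l * u + 2 ≤ cnt F? + tri l * e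
  sizeF′ = linear 0 (+-mono-≤ sizeF (bin-taylor 1 k p l p+l≡))
    (ring (bin p 1 k) (bin (2 + R) 1 k) (l * u) (cnt F?) (tri l * e))
    where
    ring : ∀ b t x f y → (x + 2) + ((f + b) + (t + y)) + 0 ≡ (f + y) + ((t + 2) + (b + x))
    ring = solve-∀

  -- Every member of `G` through `x` meets some fixed `A` in `F` that avoids `x`. This caps the
  -- degree of `x` at the binomial difference in `sizeG`, and the `+ 2` there is left over.
  2≤cnt-G∌ : ∀ {x} → x ∈ V → 2 ≤ cnt (G∌? x)
  2≤cnt-G∌ {x} x∈V with nonstarF x
  ... | A , FA , x∉A = linear 0
    (+-mono-≤ (+-mono-≤ sizeG (cnt-split G? (has? x)))
      (subst (λ z → cnt (G∋? x) + bin q 1 l ≤ bin z 1 l) q+k≡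
        (cnt-star-cover (G∋? x) (uniformG ∘ proj₁) x∈V (proj₁ (uniformF FA)) x∉A
          (proj₂ (uniformF FA)) (trans ∣V∣≡ (trans (+-comm R 3) (trans (cong suc (sym q+k≡)) (ring′ q k))))
          proj₂ (cross FA ∘ proj₁))))
    (ring (bin q 1 l) (bin (2 + R) 1 l) (cnt (G∋? x)) (cnt (G∌? x)) (cnt G?))
    where
    ring : ∀ b t s c g → 2 + (((g + b) + (s + c)) + t) + 0 ≡ c + (((t + 2) + g) + (s + b))
    ring = solve-∀
    ring′ : ∀ q k → suc (q + k) ≡ q + 1 + k
    ring′ = solve-∀

  core : Fin N → Subset N
  core x = tabulate (λ z → does (all? (G∌? x) (has? z)))

  core-⊆ : ∀ {x B} → G B → x ∉ B → core x ⊆ B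
  core-⊆ {x} b x∉B z∈ = tabulate⁻ (λ z → all? (G∌? x) (has? z)) z∈ (b , x∉B)

  ∉-core : ∀ {x z} → z ∉ core x → ∃[ B ] (G B × x ∉ B × z ∉ B)
  ∉-core {x} {z} z∉ with ∀⊎∃ (G∌? x) (has? z)
  ... | inj₁ h = contradiction (tabulate⁺ (λ z → all? (G∌? x) (has? z)) h) z∉
  ... | inj₂ (B , (b , x∉B) , z∉B) = B , b , x∉B , z∉B

  -- All these members contain the core. `Y` can be `V`, or `V` without `x` where the exact count
  -- matters.
  cnt-G∌≤ : ∀ {x Y r c} → Uniform Y l (G∌ x) → ∣ Y ∣ ≡ r + c → c ≤ ∣ core x ∣ →
    cnt (G∌? x) ≤ bin r c l
  cnt-G∌≤ {x} {Y} {r} {c} uniform ∣Y∣ c≤ = ≤-trans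
    (cnt-star (G∌? x) uniform core⊆Y refl (sym (m∸n+n≡m (p⊆q⇒∣p∣≤∣q∣ core⊆Y)))
      (λ (b , x∉B) → core-⊆ b x∉B))
    (bin-anti l c≤ (trans (m∸n+n≡m (p⊆q⇒∣p∣≤∣q∣ core⊆Y)) ∣Y∣))
    where
    core⊆Y : core x ⊆ Y
    core⊆Y with nonstarG x
    ... | B , b , x∉B = proj₁ (uniform (b , x∉B)) ∘ core-⊆ b x∉B

  -- A core of `l` points would leave room for only one member of `G` avoiding `x`.
  core-< : ∀ {x} → x ∈ V → ∣ core x ∣ < l
  core-< {x} x∈V with l ≤? ∣ core x ∣
  ... | no ≰ = ≰⇒> ≰
  ... | yes l≤ = contradiction (≤-trans (2≤cnt-G∌ x∈V) (≤-trans
    (cnt-G∌≤ (uniformG ∘ proj₁) (trans ∣V∣≡ (trans (+-comm R 3) (cong suc (sym p+l≡)))) l≤)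
    (≤-reflexive (bin-self (suc p) l)))) λ { (s≤s ()) }

  core-split : ∀ {x} → x ∈ V → ∃[ j ] ∣ core x ∣ + suc j ≡ l
  core-split {x} x∈V with m≤n⇒∃[o]m+o≡n (core-< x∈V)
  ... | j , eq = j , trans (+-suc _ j) eq

  -- Fix `B` in `G` avoiding `x`. A member of `F` through `x` meets `B` in the core, or in one of
  -- the `j` other points `y`. In the latter case some `B′` in `G` avoids both `x` and `y` and must
  -- be met in a third point, for which there are `l` choices.
  cnt-F∋≤ : ∀ {x j} → x ∈ V → ∣ core x ∣ + j ≡ l → cnt (F∋? x) ≤ ∣ core x ∣ * u + j * (l * e)
  cnt-F∋≤ {x} {j} x∈V eq with nonstarG x
  ... | B , b , x∉B = ≤-trans
    (cnt-cover (F∋? x) (F∋? x ∩? meets? (core x)) (F∋? x ∩? meets? (B ─ core x)) split)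
    (+-mono-≤
      (cnt-union (F∋? x ∩? meets? (core x)) (core x) ≤-refl proj₂ λ {y} y∈ →
        cnt-star₂ ((F∋? x ∩? meets? (core x)) ∩? has? y) (uniformF ∘ proj₁ ∘ proj₁ ∘ proj₁)
          x∈V (V⊇B (C⊆B y∈)) (λ { refl → x∉B (C⊆B y∈) }) ∣V∣≡′ (proj₂ ∘ proj₁ ∘ proj₁) proj₂)
      (cnt-union (F∋? x ∩? meets? (B ─ core x)) (B ─ core x)
        (≤-reflexive (∣p─q∣ C⊆B refl (trans (proj₂ (uniformG b)) (trans (sym eq) (+-comm _ j)))))
        proj₂ bound₃))
    where
    V⊇B : B ⊆ V
    V⊇B = proj₁ (uniformG b)
    C⊆B : core x ⊆ B
    C⊆B = core-⊆ b x∉B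
    split : ∀ {A} → F∋ x A → (F∋ x U.∩ Meets (core x)) A ⊎ (F∋ x U.∩ Meets (B ─ core x)) A
    split (a , x∈A) with meets⁻ (cross a b)
    ... | y , y∈A , y∈B with y ∈? core x
    ...   | yes y∈C = inj₁ ((a , x∈A) , meets y∈C y∈A)
    ...   | no y∉C = inj₂ ((a , x∈A) , meets (x∈p∧x∉q⇒x∈p─q y∈B y∉C) y∈A)
    bound₃ : ∀ {y} → y ∈ B ─ core x → cnt ((F∋? x ∩? meets? (B ─ core x)) ∩? has? y) ≤ l * e
    bound₃ {y} y∈ with x∈p─q⁻ B (core x) y∈
    ... | y∈B , y∉C with ∉-core y∉C
    ...   | B′ , b′ , x∉B′ , y∉B′ =
      cnt-union ((F∋? x ∩? meets? (B ─ core x)) ∩? has? y) B′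
        (≤-reflexive (proj₂ (uniformG b′))) (λ (((a , _) , _) , _) → Meets-sym (cross a b′))
        λ {z} z∈ → cnt-star₃ (((F∋? x ∩? meets? (B ─ core x)) ∩? has? y) ∩? has? z)
          (uniformF ∘ proj₁ ∘ proj₁ ∘ proj₁ ∘ proj₁)
          x∈V (V⊇B y∈B) (proj₁ (uniformG b′) z∈)
          (λ { refl → x∉B y∈B }) (λ { refl → x∉B′ z∈ }) (λ { refl → y∉B′ z∈ }) ∣V∣≡
          (proj₂ ∘ proj₁ ∘ proj₁ ∘ proj₁) (proj₂ ∘ proj₁) proj₂

  cnt-F∌-large : ∀ {x} → x ∈ V → l * e < cnt (F∌? x)
  cnt-F∌-large {x} x∈V with core-split x∈V
  ... | j , eq = excess-large eq ratioF sizeF′ (cnt-split F? (has? x)) (cnt-F∋≤ x∈V eq)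

  core-max : ∀ {x} → x ∈ V → cnt (F∌? x) ≤ u → suc ∣ core x ∣ ≡ l
  core-max {x} x∈V small with core-split x∈V
  ... | j , eq with excess-small eq ratioF sizeF′ (cnt-split F? (has? x)) (cnt-F∋≤ x∈V eq) small
  ...   | refl = trans (+-comm 1 _) eq

-- The contradiction in the case t = 1.

flip : ∀ {N} → Cross N → Cross N
flip X = record
  { R = R ; ∣V∣≡ = ∣V∣≡ ; p+l≡ = q+k≡ ; q+k≡ = p+l≡ ; 2≤k = 2≤l ; 2≤l = 2≤k
  ; F? = G? ; G? = F? ; uniformF = uniformG ; uniformG = uniformF
  ; cross = λ b a → Meets-sym (cross a b) ; nonstarF = nonstarG ; nonstarG = nonstarF
  ; ratioF = ratioG ; ratioG = ratioF ; sizeF = sizeG ; sizeG = sizeF }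
  where open Cross X

∣∅∣ : ∀ {N} {p : Subset N} → ¬ Nonempty p → ∣ p ∣ ≡ 0
∣∅∣ {N} ¬ne = trans (cong ∣_∣ (Empty-unique ¬ne)) (∣⊥∣≡0 N)

module _ {N} (X : Cross N) where

  open Cross X
  private
    -- The families are exchanged in `Y`: `Y.core x` consists of the points common to all members of
    -- `F` that avoid `x`.
    module Y = Cross (flip X)

  nonemptyF : ∃ F
  nonemptyF = cnt-∃ F? (≤-trans (s≤s z≤n) (linear {x = 2} 0
    (+-mono-≤ sizeF (bin-mono 1 k (≤-trans (m≤m+n p l) (≤-reflexive p+l≡))))
    (ring (bin (2 + R) 1 k) (bin p 1 k) (cnt F?))))
    where
    ring : ∀ t b f → 2 + ((f + b) + t) + 0 ≡ f + ((t + 2) + b)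
    ring = solve-∀

  -- Let `A` be in `F`. If some `x` in `A` has a point `y` in `Y.core x`, then `x` and `y` cover
  -- `F`. If not, all points of `A` have small degree in `G`; as `A` meets every member of `G`, the
  -- family `G` would be too small.
  cnt-F≤2deg : ∀ {M} → (∀ {x} → x ∈ V → cnt (F∋? x) ≤ M) → cnt F? ≤ M + M
  cnt-F≤2deg {M} deg with nonemptyF
  ... | A , a with Fin.any? (λ x → (x ∈? A) ×-dec nonempty? (Y.core x))
  ...   | yes (x , x∈A , y , y∈C) =
    ≤-trans (cnt-cover F? (F∋? x) (F∋? y) split) (+-mono-≤ (deg (proj₁ (uniformF a) x∈A)) (deg y∈V))
    where
    y∈V : y ∈ V
    y∈V with nonstarF x
    ... | A′ , a′ , x∉A′ = proj₁ (uniformF a′) (Y.core-⊆ a′ x∉A′ y∈C)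
    split : ∀ {S} → F S → F∋ x S ⊎ F∋ y S
    split {S} f with x ∈? S
    ... | yes x∈S = inj₁ (f , x∈S)
    ... | no x∉S = inj₂ (f , Y.core-⊆ f x∉S y∈C)
  ...   | no none = contradiction
    (cnt-union G? A (≤-reflexive (proj₂ (uniformF a))) (cross a) λ {x} x∈A →
      let c≡0 = ∣∅∣ (λ ne → none (x , x∈A , ne)) in
      ≤-trans (Y.cnt-F∋≤ (proj₁ (uniformF a) x∈A) (cong (_+ k) c≡0))
        (≤-reflexive (cong (λ c → c * Y.u + k * (k * Y.e)) c≡0)))
    (scattered-absurd (trans (+-comm 1 _) (m∸n+n≡m (≤-trans (s≤s z≤n) 2≤k))) ratioG Y.sizeF′)

  -- Three core points leave at most `Y.e` members of `G` avoiding `x`, but `Y.cnt-F∌-large` gives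
  -- more than `k * Y.e`.
  core≤2 : ∀ {x} → x ∈ V → ∣ core x ∣ ≤ 2
  core≤2 {x} x∈V with ∣ core x ∣ ≤? 2
  ... | yes ≤2 = ≤2
  ... | no ≰2 = contradiction (cnt-G∌≤ (uniformG ∘ proj₁) ∣V∣≡ (≰⇒> ≰2))
    (<⇒≱ (≤-trans (s≤s (m≤n*m Y.e k {{>-nonZero (≤-trans (s≤s z≤n) 2≤k)}})) (Y.cnt-F∌-large x∈V)))

  -- For `k ≡ 2`, `u` is 1 and `e` is 0, so degrees in `F` are bounded by core sizes and `l + 2` is
  -- at most twice the largest core. Cores of size 2 give `l ≤ 2`; then cores have size at most 1,
  -- and the same inequality fails.
  k≢2 : k ≢ 2
  k≢2 k≡2 = contradiction (l+2≤ {1} λ x∈V → s≤s⁻¹ (≤-trans (core-< x∈V) l≤2))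
    (<⇒≱ (≤-trans (s≤s (s≤s (s≤s z≤n))) (+-monoˡ-≤ 2 2≤l)))
    where
    open ≤-Reasoning
    u≡1 : u ≡ 1
    u≡1 = cong (bin (suc R) 2) k≡2
    e≡0 : e ≡ 0
    e≡0 = cong (bin R 3) k≡2
    l+2≤ : ∀ {m} → (∀ {x} → x ∈ V → ∣ core x ∣ ≤ m) → l + 2 ≤ m + m
    l+2≤ {m} core≤ = begin
      l + 2                ≡⟨ cong (_+ 2) (trans (cong (l *_) u≡1) (*-identityʳ l)) ⟨
      l * u + 2            ≤⟨ sizeF′ ⟩
      cnt F? + tri l * e   ≡⟨ cong (cnt F? +_) (trans (cong (tri l *_) e≡0) (*-zeroʳ (tri l))) ⟩
      cnt F? + 0           ≡⟨ +-identityʳ _ ⟩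
      cnt F?               ≤⟨ cnt-F≤2deg deg ⟩
      m + m                ∎
      where
      deg : ∀ {x} → x ∈ V → cnt (F∋? x) ≤ m
      deg {x} x∈V with core-split x∈V
      ... | j , eq = begin
        cnt (F∋? x)                              ≤⟨ cnt-F∋≤ x∈V eq ⟩
        ∣ core x ∣ * u + suc j * (l * e)         ≡⟨ cong₂ _+_
          (trans (cong (∣ core x ∣ *_) u≡1) (*-identityʳ _))
          (trans (cong (λ z → suc j * (l * z)) e≡0)
            (trans (cong (suc j *_) (*-zeroʳ l)) (*-zeroʳ (suc j)))) ⟩
        ∣ core x ∣ + 0                           ≡⟨ +-identityʳ _ ⟩
        ∣ core x ∣                               ≤⟨ core≤ x∈V ⟩
        m                                        ∎
    l≤2 : l ≤ 2
    l≤2 = +-cancelʳ-≤ 2 l 2 (l+2≤ core≤2)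

  l*e≤u : l * e ≤ u
  l*e≤u = ≤-trans (*-monoˡ-≤ e (m≤m*m l)) (≤-trans (m≤m+n _ _) ratioF)

  core≤1-absurd : 3 ≤ l → ¬ (∀ {x} → x ∈ V → ∣ core x ∣ ≤ 1)
  core≤1-absurd 3≤l core≤1 with m≤n⇒∃[o]m+o≡n 3≤l
  ... | i , 3+i≡l = star-absurd 3+i≡l ratioF sizeF′ (cnt-F≤2deg deg)
    where
    deg : ∀ {x} → x ∈ V → cnt (F∋? x) ≤ u + (2 + i) * (l * e)
    deg {x} x∈V with core-split x∈V
    ... | j , eq = few (core≤1 x∈V) (trans eq (sym 3+i≡l)) (cnt-F∋≤ x∈V eq)
      where
      few : ∀ {c M} → c ≤ 1 → c + suc j ≡ 3 + i → M ≤ c * u + suc j * (l * e) →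
        M ≤ u + (2 + i) * (l * e)
      -- With an empty core, one of the `l` terms `l * e` is absorbed by `u`.
      few z≤n refl h = ≤-trans h (+-monoˡ-≤ ((2 + i) * (l * e)) l*e≤u)
      few (s≤s z≤n) refl h = ≤-trans h (≤-reflexive (cong (_+ (2 + i) * (l * e)) (*-identityˡ u)))

  -- Both cores have two elements, which forces k = l = 3; this is the only case in
  -- which the bound is attained up to the last unit.
  core≡2-absurd : ∀ {x} → x ∈ V → ∣ core x ∣ ≡ 2 → ∣ Y.core x ∣ ≡ 2 → k ≡ 3 → l ≡ 3 → ⊥
  core≡2-absurd {x} x∈V c≡2 c′≡2 k≡3 l≡3 = contradiction bad λ ()
    where
    core⊆V : core x ⊆ V
    core⊆V with nonstarG x
    ... | B , b , x∉B = proj₁ (uniformG b) ∘ core-⊆ b x∉B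
    x∉core : x ∉ core x
    x∉core x∈ with nonstarG x
    ... | B , b , x∉B = x∉B (core-⊆ b x∉B x∈)
    -- If `A` through `x` missed the core, each member of `G` avoiding `x` would contain both core
    -- points and a third point, in `A`; there are at most `k * Y.e` such sets.
    F∋-meets : ∀ {A} → F∋ x A → Meets (core x) A
    F∋-meets with ∀⊎∃ (F∋? x) (meets? (core x))
    ... | inj₁ h = h
    ... | inj₂ (A , (a , x∈A) , ¬m) = contradiction
      (cnt-union (G∌? x) A (≤-reflexive (proj₂ (uniformF a))) (cross a ∘ proj₁) λ {y} y∈A →
        cnt-star (G∌? x ∩? has? y) (uniformG ∘ proj₁ ∘ proj₁)
          (∪-⊆ (⁅x⁆⊆ (proj₁ (uniformF a) y∈A)) core⊆V)
          (trans (∣⁅x⁆∪p∣ (λ y∈C → ¬m (meets y∈C y∈A))) (cong suc c≡2)) ∣V∣≡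
          (λ ((b , x∉B) , y∈B) → ∪-⊆ (⁅x⁆⊆ y∈B) (core-⊆ b x∉B)))
      (<⇒≱ (Y.cnt-F∌-large x∈V))
    F∋-bound : cnt (F∋? x) + bin R 1 k ≤ bin (2 + R) 1 k
    F∋-bound = subst (λ z → cnt (F∋? x) + bin R 1 k ≤ bin z 1 k) (+-comm R 2)
      (cnt-star-cover (F∋? x) (uniformF ∘ proj₁) x∈V core⊆V x∉core c≡2
        (trans ∣V∣≡ (sym (+-assoc R 1 2))) proj₂ F∋-meets)
    -- Here `x` is deleted from the ground set, which gives `bin R` instead of `bin (suc R)`; the
    -- final count has no slack.
    F∌-bound : cnt (F∌? x) ≤ bin R 2 k
    F∌-bound = Y.cnt-G∌≤ {Y = V ─ ⁅ x ⁆}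
      (λ (a , x∉A) → ⊆─ (proj₁ (uniformF a)) (λ m → let (y , y∈x , y∈A) = meets⁻ m in
        x∉A (subst (_∈ _) (x∈⁅y⁆⇒x≡y x y∈x) y∈A)) , proj₂ (uniformF a))
      (∣p─q∣ (⁅x⁆⊆ x∈V) (∣⁅x⁆∣≡1 x) (trans ∣V∣≡ (sym (+-assoc R 2 1)))) (≤-reflexive (sym c′≡2))
    1+p≡R : suc p ≡ R
    1+p≡R = suc-injective (suc-injective (trans (+-comm 3 p) (trans (cong (p +_) (sym l≡3)) p+l≡)))
    -- As `R` is `suc p`, Pascal's rule lets the terms `bin p 2 k` cancel, and `bin p 3 k` is 1. The
    -- two bounds thus allow one member fewer than `sizeF` demands.
    bad : 1 ≤ 0
    bad = linear 0
      (+-mono-≤ (+-mono-≤ sizeF (cnt-split F? (has? x))) (+-mono-≤ F∋-bound F∌-bound)) (trans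
        (cong (λ r → 1 + (((cnt F? + bin p 1 k) + (cnt (F∋? x) + cnt (F∌? x)))
          + (bin (2 + R) 1 k + bin r 2 k)) + 0) (sym 1+p≡R))
        (trans (cong (λ z → 1 + (((cnt F? + bin p 1 k) + (cnt (F∋? x) + cnt (F∌? x)))
            + (bin (2 + R) 1 k + z)) + 0)
          (trans (pascal p 2 k) (cong (bin p 2 k +_) (trans (cong (bin p 3) k≡3) (bin-self p 3)))))
        (trans (ring (cnt F?) (bin p 1 k) (bin p 2 k) (cnt (F∋? x)) (cnt (F∌? x)) (bin (2 + R) 1 k))
        (cong (λ z → 0 + (((bin (2 + R) 1 k + 2) + cnt F?) + ((cnt (F∋? x) + z) + cnt (F∌? x))))
          (sym (trans (cong (λ r → bin r 1 k) (sym 1+p≡R)) (pascal p 1 k)))))))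
      where
      ring : ∀ f b₁ b₂ s c t →
        1 + (((f + b₁) + (s + c)) + (t + (b₂ + 1))) + 0 ≡
        0 + (((t + 2) + f) + ((s + (b₁ + b₂)) + c))
      ring = solve-∀

-- A core of size 2 at `x` leaves at most `Y.u` members of `G` avoiding `x`, so the other core has
-- size `k - 1` by `Y.core-max`, and `core≤2` forces `k ≡ 3`. The same argument back gives `l ≡ 3`.
cross-absurd : ∀ {N} → ¬ Cross N
cross-absurd X with Cross.k X ≟ 2 | Cross.l X ≟ 2
... | yes k≡2 | _ = k≢2 X k≡2
... | no _ | yes l≡2 = k≢2 (flip X) l≡2
... | no k≢ | no l≢ with Fin.any? (λ x → (x ∈? Cross.V X) ×-dec (2 ≤? ∣ Cross.core X x ∣))
...   | no none = core≤1-absurd X (≤∧≢⇒< (Cross.2≤l X) (l≢ ∘ sym))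
  (λ {x} x∈V → s≤s⁻¹ (≰⇒> (λ 2≤c → none (x , x∈V , 2≤c))))
...   | yes (x , x∈V , 2≤c) = core≡2-absurd X x∈V c≡2 c′≡2 k≡3 l≡3
  where
  open Cross X
  module Y = Cross (flip X)
  c≡2 : ∣ core x ∣ ≡ 2
  c≡2 = ≤-antisym (core≤2 X x∈V) 2≤c
  1+c′≡k : suc ∣ Y.core x ∣ ≡ k
  1+c′≡k = Y.core-max x∈V (cnt-G∌≤ (uniformG ∘ proj₁) ∣V∣≡′ 2≤c)
  c′≡2 : ∣ Y.core x ∣ ≡ 2
  c′≡2 = ≤-antisym (core≤2 (flip X) x∈V)
    (s≤s⁻¹ (≤-trans (≤∧≢⇒< 2≤k (k≢ ∘ sym)) (≤-reflexive (sym 1+c′≡k))))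
  k≡3 : k ≡ 3
  k≡3 = trans (sym 1+c′≡k) (cong suc c′≡2)
  l≡3 : l ≡ 3
  l≡3 = trans (sym (core-max x∈V (Y.cnt-G∌≤ (uniformF ∘ proj₁) ∣V∣≡′ (≤-reflexive (sym c′≡2)))))
    (cong suc c≡2)

-- Rainbow matchings and common covers for predicates.

Rainbow : ∀ {N q} → (Fin q → U.Pred (Subset N) 0ℓ) → Set
Rainbow {N} {q} P = Σ[ e ∈ (Fin q → Subset N) ]
  (∀ i → P i (e i)) × (∀ i j → i ≢ j → Empty (e i ∩ e j))

Cover : ∀ {N q} → Subset N → ℕ → (Fin q → U.Pred (Subset N) 0ℓ) → Set
Cover {N} V t P = Σ[ W ∈ Subset N ] (W ⊆ V × ∣ W ∣ ≡ t × (∀ i {S} → P i S → Meets W S))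

rainbow-snoc : ∀ {N q} {P : Fin (suc q) → U.Pred (Subset N) 0ℓ} {A} →
  ((e , _) : Rainbow (P ∘ inject₁)) → P (fromℕ q) A → (∀ i → ¬ Meets (e i) A) → Rainbow P
rainbow-snoc {N} {q} {P} {A} (e , e∈ , disjoint) a ¬m =
  (λ i → pick (view i)) , (λ i → pick∈ (view i)) , λ i j → pick-disjoint (view i) (view j)
  where
  pick : ∀ {i : Fin (suc q)} → View i → Subset N
  pick ‵fromℕ = A
  pick (‵inject₁ i) = e i
  pick∈ : ∀ {i} (v : View i) → P i (pick v)
  pick∈ ‵fromℕ = a
  pick∈ (‵inject₁ i) = e∈ i
  pick-disjoint : ∀ {i j} (v : View i) (w : View j) → i ≢ j → Empty (pick v ∩ pick w)
  pick-disjoint ‵fromℕ ‵fromℕ i≢j = contradiction refl i≢j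
  pick-disjoint ‵fromℕ (‵inject₁ j) _ = ¬m j ∘ Meets-sym
  pick-disjoint (‵inject₁ i) ‵fromℕ _ = ¬m i
  pick-disjoint (‵inject₁ i) (‵inject₁ j) i≢j = disjoint i j (i≢j ∘ cong inject₁)

union : ∀ {N q} → (Fin q → Subset N) → Subset N
union {q = zero} e = ∅
union {q = suc q} e = e zero ∪ union (e ∘ suc)

∈-union⁺ : ∀ {N q} (e : Fin q → Subset N) i {x} → x ∈ e i → x ∈ union e
∈-union⁺ e zero x∈ = p⊆p∪q (union (e ∘ suc)) x∈
∈-union⁺ e (suc i) x∈ = q⊆p∪q (e zero) (union (e ∘ suc)) (∈-union⁺ (e ∘ suc) i x∈)

∈-union⁻ : ∀ {N q} (e : Fin q → Subset N) {x} → x ∈ union e → ∃[ i ] x ∈ e i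
∈-union⁻ {q = zero} e x∈ = contradiction x∈ ∉⊥
∈-union⁻ {q = suc q} e x∈ with x∈p∪q⁻ (e zero) (union (e ∘ suc)) x∈
... | inj₁ x∈₀ = zero , x∈₀
... | inj₂ x∈′ = let (i , x∈ᵢ) = ∈-union⁻ (e ∘ suc) x∈′ in suc i , x∈ᵢ

∣union∣ : ∀ {N q K} (e : Fin q → Subset N) → (∀ i → ∣ e i ∣ ≤ K) → ∣ union e ∣ ≤ q * K
∣union∣ {N} {zero} e h = ≤-reflexive (∣⊥∣≡0 N)
∣union∣ {N} {suc q} e h = ≤-trans (∣p∪q∣≤∣p∣+∣q∣ (e zero) (union (e ∘ suc)))
  (+-mono-≤ (h zero) (∣union∣ (e ∘ suc) (h ∘ suc)))

-- The hypotheses on the sizes and their first consequences.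

-- The lower bound on |F_i| for n = t + m, with the subtractions of binomial
-- coefficients moved to the other side.
Large : ∀ {N} {P : U.Pred (Subset N) 0ℓ} → U.Decidable P → (t m k l : ℕ) → Set
Large P? t m k l = (t + m) C k + 1 < cnt P? + m C k + bin (m ∸ l) 1 k

-- Enlarging `m ∸ l` to `m` and applying Pascal's rule gives a bound that still excludes covers by
-- `t - 1` points, in the form that `large⇒rainbow` asks for.
large-suc : ∀ {N} {P : U.Pred (Subset N) 0ℓ} (P? : U.Decidable P) t m k l →
  Large P? t m k l → (t + m) C k + 1 < cnt P? + suc m C k
large-suc P? t m k l h = ≤-trans h (≤-trans
  (+-monoʳ-≤ (cnt P? + m C k) (bin-mono 1 k (m∸n≤m m l)))
  (≤-reflexive (trans (+-assoc (cnt P?) (m C k) (bin m 1 k)) (cong (cnt P? +_) (sym (pascal m 0 k))))))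

1+l≤2l²k : ∀ {k l} → 2 ≤ k → 2 ≤ l → suc l ≤ 2 * (l * l) * k
1+l≤2l²k {k} {l} 2≤k 2≤l = begin
  suc l                 ≤⟨ +-monoˡ-≤ l (≤-trans (s≤s z≤n) 2≤l) ⟩
  l + l                 ≤⟨ +-mono-≤ (m≤m*m l) (m≤m*m l) ⟩
  l * l + l * l         ≡⟨ cong (l * l +_) (+-identityʳ (l * l)) ⟨
  2 * (l * l)           ≤⟨ m≤m*n (2 * (l * l)) k {{>-nonZero (≤-trans (s≤s z≤n) 2≤k)}} ⟩
  2 * (l * l) * k       ∎
  where open ≤-Reasoning

-- This is `bin-ratio` with the factor `2 * (l * l)`. Passing from `k` to `k - 2` gains
-- `4 * (l * l)`, more than the difference between `3 + R` and `suc R`.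
ratio : ∀ {k l R} → 2 ≤ k → 2 ≤ l → 2 * (l * l) * k ≤ 3 + R →
  l * l * bin R 3 k + l * l * bin R 3 k ≤ bin (suc R) 2 k
ratio {k} {l} {R} 2≤k 2≤l h with m≤n⇒∃[o]m+o≡n 2≤k
... | j , refl = ≤-trans (≤-reflexive (ring₁ (l * l) (bin R 3 (2 + j)))) (bin-ratio R 2 j (2 * (l * l))
  (linear (3 * (l * l)) (+-mono-≤ h (≤-trans 2≤l (m≤m*m l))) (ring₂ (l * l) j R)))
  where
  ring₂ : ∀ a j R → 2 * a * j + ((3 + R) + a) + 3 * a ≡ suc R + (2 * a * (2 + j) + 2)
  ring₂ = solve-∀
  ring₁ : ∀ a e → a * e + a * e ≡ 2 * a * e
  ring₁ = solve-∀

-- If some `B` in `G` avoided `x`, all members of `F` would contain `x` and meet `B`, and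
-- `cnt-star-cover` allows fewer of these than `Large` requires.
star-transfer : ∀ {N} {F G : U.Pred (Subset N) 0ℓ} (F? : U.Decidable F) (G? : U.Decidable G)
  {V k l m l′ x} → Uniform V k F → Uniform V l G → (∀ {A B} → F A → G B → Meets A B) →
  ∣ V ∣ ≡ 1 + m → l ≤ m → l ≤ l′ → Large F? 1 m k l′ → x ∈ V →
  (∀ {A} → F A → x ∈ A) → ∀ {B} → G B → x ∈ B
star-transfer F? G? {V} {k} {l} {m} {l′} {x} uniformF uniformG cross ∣V∣ l≤m l≤l′ large x∈V star
  with ∀⊎∃ G? (has? x)
... | inj₁ h = h
... | inj₂ (B , b , x∉B) = contradiction bad λ ()
  where
  F-bound : cnt F? + bin (m ∸ l) 1 k ≤ bin m 1 k
  F-bound = subst (λ z → cnt F? + bin (m ∸ l) 1 k ≤ bin z 1 k) (m∸n+n≡m l≤m)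
    (cnt-star-cover F? uniformF x∈V (proj₁ (uniformG b)) x∉B (proj₂ (uniformG b))
      (trans ∣V∣ (trans (cong suc (sym (m∸n+n≡m l≤m))) (ring (m ∸ l) l)))
      star (λ a → Meets-sym (cross a b)))
    where
    ring : ∀ r l → suc (r + l) ≡ r + 1 + l
    ring = solve-∀
  bad : 2 ≤ 0
  bad = linear 0 (+-mono-≤ large (+-mono-≤ F-bound (bin-mono 1 k (∸-monoʳ-≤ m l≤l′))))
    (trans (ring (cnt F?) (m C k) (bin (m ∸ l′) 1 k) (bin m 1 k) (bin (m ∸ l) 1 k))
      (cong (λ z → 0 + (suc (z + 1) + ((cnt F? + bin (m ∸ l) 1 k) + bin (m ∸ l′) 1 k)))
        (sym (pascal m 0 k))))
    where
    ring : ∀ f c a b d → 2 + (((f + c) + a) + (b + d)) + 0 ≡ 0 + (suc ((c + b) + 1) + ((f + d) + a))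
    ring = solve-∀

nonempty : ∀ {N} {P : U.Pred (Subset N) 0ℓ} (P? : U.Decidable P) t m k l → Large P? (suc t) m k l → ∃ P
nonempty P? t m k l h = cnt-∃ P? (≤-trans (s≤s z≤n) (linear {x = 2} 0
  (+-mono-≤ (large-suc P? (suc t) m k l h) (bin-mono 0 k (s≤s (m≤n+m m t))))
  (ring (cnt P?) (suc m C k) ((suc t + m) C k))))
  where
  ring : ∀ p a b → 2 + ((p + a) + b) + 0 ≡ p + (suc (b + 1) + a)
  ring = solve-∀

cross-bound : ∀ {N} {P : U.Pred (Subset N) 0ℓ} (P? : U.Decidable P) {R k l l′} → l ≤ l′ →
  Large P? 1 (2 + R) k l′ → bin (2 + R) 1 k + 2 ≤ cnt P? + bin (2 + R ∸ l) 1 k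
cross-bound P? {R} {k} {l} {l′} l≤l′ h = linear 0 (+-mono-≤ h (bin-mono 1 k (∸-monoʳ-≤ (2 + R) l≤l′)))
  (trans (ring (cnt P?) ((2 + R) C k) (bin (2 + R ∸ l′) 1 k) (bin (2 + R) 1 k) (bin (2 + R ∸ l) 1 k))
    (cong (λ z → (cnt P? + bin (2 + R ∸ l) 1 k) + (suc (z + 1) + bin (2 + R ∸ l′) 1 k))
      (sym (pascal (2 + R) 0 k))))
  where
  ring : ∀ f c a b d → (b + 2) + (((f + c) + a) + d) + 0 ≡ (f + d) + (suc ((c + b) + 1) + a)
  ring = solve-∀

-- The statement for the induction, and its base case.

-- Here l i is the number k_{3-i} or k_3 in the bound for the i-th family, of which only
-- inequalities inherited by initial segments of the sequence of families are kept.
record Sizes (K L s : ℕ) (k l : Fin (2 + s) → ℕ) : Set where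
  field
    2≤k   : ∀ i → 2 ≤ k i
    k≤K   : ∀ i → k i ≤ K
    k≤L   : ∀ i → k (suc i) ≤ L
    k₁≤l₀ : k (suc zero) ≤ l zero
    k₀≤l₁ : k zero ≤ l (suc zero)
    k≤l   : ∀ i j → k (suc (suc j)) ≤ l i

-- The ground set is a subset `V` of `Fin N`, so that points can be deleted without renumbering. `K`
-- and `L` stand for k₁ and k₂ and stay fixed in the induction; t is `suc s` and n is `suc s + m`.
Theorem : ℕ → ℕ → ℕ → Set₁
Theorem K L s = ∀ {N} {k l : Fin (2 + s) → ℕ} → Sizes K L s k l → ∀ {V : Subset N} {m} →
  ∣ V ∣ ≡ suc s + m → 2 * (K * K) * L * suc s ≤ suc s + m →
  ∀ {P : Fin (2 + s) → U.Pred (Subset N) 0ℓ} (P? : ∀ i → U.Decidable (P i)) →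
  (∀ i → Uniform V (k i) (P i)) → (∀ i → Large (P? i) (suc s) m (k i) (l i)) →
  Rainbow P ⊎ Cover V (suc s) P

base : ∀ {K L} → L ≤ K → Theorem K L 0
base {K} {L} L≤K {N} {k} {l} sizes {V} {m} ∣V∣ n-large {P} P? uniform large
  with anySubset? (λ A → P? zero A ×-dec anySubset? (λ B → P? (suc zero) B ×-dec ¬? (meets? A B)))
... | yes (A , a , B , b , ¬m) = inj₁
  ( (λ { zero → A ; (suc zero) → B })
  , (λ { zero → a ; (suc zero) → b })
  , λ { zero zero i≢i → contradiction refl i≢i ; zero (suc zero) _ → ¬m
      ; (suc zero) zero _ → ¬m ∘ Meets-sym ; (suc zero) (suc zero) i≢i → contradiction refl i≢i } )
... | no ¬disjoint = inj₂ cover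
  where
  open Sizes sizes
  open ≤-Reasoning
  F G : U.Pred (Subset N) 0ℓ
  F = P zero
  G = P (suc zero)
  F? : U.Decidable F
  F? = P? zero
  G? : U.Decidable G
  G? = P? (suc zero)
  k₀ k₁ : ℕ
  k₀ = k zero
  k₁ = k (suc zero)
  cross : ∀ {A B} → F A → G B → Meets A B
  cross {A} {B} a b = decidable-stable (meets? A B) (λ ¬m → ¬disjoint (A , a , B , b , ¬m))
  n-large′ : 2 * (K * K) * L ≤ 1 + m
  n-large′ = ≤-trans (≤-reflexive (sym (*-identityʳ _))) n-large
  -- One factor `k₁` changes places with `k₀`, since only `k₁` is known to be at most `L`.
  n-large₀ : 2 * (k₁ * k₁) * k₀ ≤ 1 + m
  n-large₀ = begin
    2 * (k₁ * k₁) * k₀   ≡⟨ swap k₁ k₀ ⟩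
    2 * (k₁ * k₀) * k₁   ≤⟨ *-mono-≤ (*-monoʳ-≤ 2 (*-mono-≤ (k≤K _) (k≤K _))) (k≤L zero) ⟩
    2 * (K * K) * L      ≤⟨ n-large′ ⟩
    1 + m                ∎
    where
    swap : ∀ a b → 2 * (a * a) * b ≡ 2 * (a * b) * a
    swap = solve-∀
  n-large₁ : 2 * (k₀ * k₀) * k₁ ≤ 1 + m
  n-large₁ = ≤-trans (*-mono-≤ (*-monoʳ-≤ 2 (*-mono-≤ (k≤K _) (k≤K _))) (k≤L zero)) n-large′
  k₁≤m : k₁ ≤ m
  k₁≤m = s≤s⁻¹ (≤-trans (1+l≤2l²k (2≤k _) (2≤k _)) n-large₀)
  k₀≤m : k₀ ≤ m
  k₀≤m = s≤s⁻¹ (≤-trans (1+l≤2l²k (2≤k _) (2≤k _)) n-large₁)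
  star : ∀ {x} → x ∈ V → (∀ {A} → F A → x ∈ A) → (∀ {B} → G B → x ∈ B) → Cover V 1 P
  star {x} x∈V f g = ⁅ x ⁆ , ⁅x⁆⊆ x∈V , ∣⁅x⁆∣≡1 x ,
    λ { zero a → meets (x∈⁅x⁆ x) (f a) ; (suc zero) b → meets (x∈⁅x⁆ x) (g b) }
  cover : Cover V 1 P
  cover with Fin.any? (λ x → all? F? (has? x)) | Fin.any? (λ x → all? G? (has? x))
  ... | yes (x , f) | _ = star x∈V f (star-transfer F? G? {k = k₀} {l′ = l zero}
      (uniform zero) (uniform (suc zero)) cross ∣V∣ k₁≤m k₁≤l₀ (large zero) x∈V f)
    where
    x∈V : x ∈ V
    x∈V = let (A , a) = nonempty F? 0 m k₀ (l zero) (large zero) in proj₁ (uniform zero a) (f a)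
  ... | no _ | yes (x , g) = star x∈V (star-transfer G? F? {k = k₁} {l′ = l (suc zero)}
      (uniform (suc zero)) (uniform zero) (λ b a → Meets-sym (cross a b)) ∣V∣ k₀≤m k₀≤l₁ (large (suc zero)) x∈V g) g
    where
    x∈V : x ∈ V
    x∈V = let (B , b) = nonempty G? 0 m k₁ (l (suc zero)) (large (suc zero)) in
      proj₁ (uniform (suc zero) b) (g b)
  ... | no ¬starF | no ¬starG with m≤n⇒∃[o]m+o≡n (≤-trans (2≤k zero) k₀≤m)
  ...   | R , refl = contradiction (record
    { R = R ; ∣V∣≡ = trans ∣V∣ (+-comm 3 R)
    ; p+l≡ = m∸n+n≡m k₁≤m ; q+k≡ = m∸n+n≡m k₀≤m
    ; 2≤k = 2≤k zero ; 2≤l = 2≤k (suc zero) ; F? = F? ; G? = G?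
    ; uniformF = uniform zero ; uniformG = uniform (suc zero) ; cross = cross
    ; nonstarF = nonstar F? ¬starF ; nonstarG = nonstar G? ¬starG
    ; ratioF = ratio (2≤k zero) (2≤k (suc zero)) n-large₀
    ; ratioG = ratio (2≤k (suc zero)) (2≤k zero) n-large₁
    ; sizeF = cross-bound F? {R} {k₀} k₁≤l₀ (large zero)
    ; sizeG = cross-bound G? {R} {k₁} k₀≤l₁ (large (suc zero)) })
    cross-absurd
    where
    nonstar : ∀ {H : U.Pred (Subset N) 0ℓ} (H? : U.Decidable H) →
      ¬ (∃[ x ] (∀ {S} → H S → x ∈ S)) → ∀ x → ∃[ A ] (H A × x ∉ A)
    nonstar H? ¬star x with ∀⊎∃ H? (has? x)
    ... | inj₁ h = contradiction (x , λ {S} → h {S}) ¬star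
    ... | inj₂ e = e

-- The induction step.

prefix : ∀ {K L s k l} → Sizes K L (suc s) k l → Sizes K L s (k ∘ inject₁) (l ∘ inject₁)
prefix sizes = record
  { 2≤k = λ i → 2≤k (inject₁ i) ; k≤K = λ i → k≤K (inject₁ i) ; k≤L = λ i → k≤L (inject₁ i)
  ; k₁≤l₀ = k₁≤l₀ ; k₀≤l₁ = k₀≤l₁ ; k≤l = λ i j → k≤l (inject₁ i) (inject₁ j) }
  where open Sizes sizes

-- The bound on the sizes excludes a cover by suc s points.
large⇒rainbow : ∀ {K L s} → Theorem K L s →
  ∀ {N} {k l : Fin (2 + s) → ℕ} → Sizes K L s k l → ∀ {V : Subset N} {m} →
  ∣ V ∣ ≡ suc s + m → 2 * (K * K) * L * suc s ≤ suc s + m →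
  ∀ {P : Fin (2 + s) → U.Pred (Subset N) 0ℓ} (P? : ∀ i → U.Decidable (P i)) →
  (∀ i → Uniform V (k i) (P i)) → (∀ i → (suc s + m) C k i + 1 < cnt (P? i) + m C k i) →
  Rainbow P
large⇒rainbow {s = s} theorem {k = k} {l} sizes {m = m} ∣V∣ n-large P? uniform large
  with theorem sizes ∣V∣ n-large P? uniform (λ i → ≤-trans (large i) (m≤m+n _ (bin (m ∸ l i) 1 (k i))))
... | inj₁ rainbow = rainbow
... | inj₂ (W , W⊆V , ∣W∣ , cover) = contradiction
  (cnt-cover-bound (P? zero) (uniform zero) W⊆V ∣W∣ (trans ∣V∣ (+-comm (suc s) m)) (cover zero))
  (<⇒≱ (subst (λ z → z C k zero < cnt (P? zero) + m C k zero) (+-comm (suc s) m)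
    (≤-trans (s≤s (m≤m+n _ 1)) (large zero))))

-- A rainbow matching of t = `2 + s` sets has at most `t * K` points. If these cover the last
-- family, this bound makes one of them have degree above `t * K * D`. By `bin-taylor` the family
-- has about `suc s` times as many members as there are `k`-sets through a point, and the lower
-- bound on n makes the latter a large multiple of `D`.
degree-large : ∀ {N} {P : U.Pred (Subset N) 0ℓ} (P? : U.Decidable P) {s m k l K L} →
  2 ≤ k → k ≤ K → k ≤ L → 2 * (K * K) * L * (2 + s) ≤ 2 + s + m → Large P? (2 + s) m k l →
  (2 + s) * K * ((2 + s) * K * bin (s + m) 2 k) < cnt P?
degree-large P? {s} {m} {suc j} {l} {K} {L} (s≤s 1≤j) k≤K k≤L n-large large =
  linear (1 + (t * s * (K * K) + suc s) * D)
    (+-mono-≤ (+-mono-≤ (large-suc P? t m k l large)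
      (bin-taylor 0 k (suc m) (suc s) (cong suc (trans (+-suc m s) (cong suc (+-comm m s))))))
      (+-mono-≤ (*-monoʳ-≤ (suc s) (bin-ratio (s + m) 1 j (2 * (K * K) * t + t) ratio-large))
        (*-monoˡ-≤ D (tri≤))))
    (ring s K D (cnt P?) (suc m C k) ((t + m) C k) (bin (suc (s + m)) 1 k) (tri (suc s)))
  where
  k = suc j
  t = 2 + s
  D = bin (s + m) 2 k
  tri≤ : tri (suc s) ≤ suc s * suc s
  tri≤ = ≤-trans (m≤m+n _ (suc s)) (tri+a≤a*a (suc s))
  -- The first summand of the factor pays for the square of `t * K`, as `2 * suc s` is at least `t`;
  -- the second pays for the error term `tri (suc s) * D`.
  ratio-large : (2 * (K * K) * t + t) * j ≤ suc (s + m)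
  ratio-large = linear (K * K * t + suc s)
    (+-mono-≤ (≤-trans (*-monoˡ-≤ t (*-monoʳ-≤ (2 * (K * K)) k≤L)) n-large)
      (*-monoʳ-≤ t (≤-trans k≤K (m≤m*m K))))
    (ring′ s K j m)
    where
    ring′ : ∀ s K j m → (2 * (K * K) * (2 + s) + (2 + s)) * j +
      ((2 + s + m) + (2 + s) * (K * K)) + (K * K * (2 + s) + suc s) ≡
      suc (s + m) + (2 * (K * K) * suc j * (2 + s) + (2 + s) * suc j)
    ring′ = solve-∀
  ring : ∀ s K D p a c b τ → suc ((2 + s) * K * ((2 + s) * K * D)) +
    (((p + a) + (c + τ * D)) + (suc s * b + suc s * suc s * D)) +
    (1 + ((2 + s) * s * (K * K) + suc s) * D) ≡
    p + ((suc (c + 1) + (a + suc s * b)) +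
      (suc s * ((2 * (K * K) * (2 + s) + (2 + s)) * D) + τ * D))
  ring = solve-∀

-- Members meeting `A` are among the `k`-sets meeting both `W` and `A`. There are `(t + m) C k`
-- minus `m C k` sets that meet `W`; those of them that miss `A` lie in `V ─ A`, which still
-- contains `W`, so they number `(t + r) C k` minus `r C k`.
avoiding-large : ∀ {N} {Q : U.Pred (Subset N) 0ℓ} (Q? : U.Decidable Q) {V W A : Subset N} {k t m r} →
  Uniform V k Q → W ⊆ V → A ⊆ V → ¬ Meets W A → ∣ W ∣ ≡ t → ∣ A ∣ + r ≡ m → ∣ V ∣ ≡ t + m →
  (∀ {S} → Q S → Meets W S) →
  cnt (Q? ∩? meets? A) + ((t + r) C k + m C k) ≤ (t + m) C k + r C k
avoiding-large Q? {V} {W} {A} {k} {t} {m} {r} uniform W⊆V A⊆V ¬m ∣W∣ ∣A∣ ∣V∣ cover = begin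
  cnt QA? + ((t + r) C k + m C k)
    ≡⟨ cong (λ z → cnt QA? + (z C k + m C k)) ∣V─A∣ ⟨
  cnt QA? + (∣ V ─ A ∣ C k + m C k)
    ≡⟨ cong (λ z → cnt QA? + (z + m C k)) (cnt-all (V ─ A) k) ⟨
  cnt QA? + (cnt (between? ∅ (V ─ A) k) + m C k)
    ≤⟨ +-monoʳ-≤ (cnt QA?) (+-monoˡ-≤ (m C k)
         (cnt-cover (between? ∅ (V ─ A) k) (Z? ∩? ∁? (meets? A)) (between? ∅ (V ─ A ─ W) k) split)) ⟩
  cnt QA? + ((cnt (Z? ∩? ∁? (meets? A)) + cnt (between? ∅ (V ─ A ─ W) k)) + m C k)
    ≡⟨ cong (λ z → cnt QA? + ((cnt (Z? ∩? ∁? (meets? A)) + z) + m C k))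
         (trans (cnt-all (V ─ A ─ W) k) (cong (_C k) ∣V─A─W∣)) ⟩
  cnt QA? + ((cnt (Z? ∩? ∁? (meets? A)) + r C k) + m C k)
    ≡⟨ rearr (cnt QA?) (cnt (Z? ∩? ∁? (meets? A))) (r C k) (m C k) ⟩
  ((cnt QA? + cnt (Z? ∩? ∁? (meets? A))) + m C k) + r C k
    ≤⟨ +-monoˡ-≤ (r C k) (+-monoˡ-≤ (m C k) (cnt-disjoint Z? QA? (Z? ∩? ∁? (meets? A))
         (λ (q , _) → (⊆-min _ , uniform q) , cover q) proj₁ (λ (_ , mA) (_ , ¬mA) → ¬mA mA))) ⟩
  (cnt Z? + m C k) + r C k
    ≤⟨ +-monoˡ-≤ (r C k) (cnt-cover-bound Z? (λ ((_ , f) , _) → f) W⊆V ∣W∣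
         (trans ∣V∣ (+-comm t m)) proj₂) ⟩
  (m + t) C k + r C k
    ≡⟨ cong (λ z → z C k + r C k) (+-comm m t) ⟩
  (t + m) C k + r C k ∎
  where
  open ≤-Reasoning
  QA? = Q? ∩? meets? A
  Z? = between? ∅ V k ∩? meets? W
  ∣V─A∣ : ∣ V ─ A ∣ ≡ t + r
  ∣V─A∣ = ∣p─q∣ A⊆V refl
    (trans ∣V∣ (trans (cong (t +_) (trans (sym ∣A∣) (+-comm _ r))) (sym (+-assoc t r _))))
  ∣V─A─W∣ : ∣ V ─ A ─ W ∣ ≡ r
  ∣V─A─W∣ = ∣p─q∣ (⊆─ W⊆V (¬m ∘ Meets-sym)) ∣W∣ (trans ∣V─A∣ (+-comm t r))
  split : ∀ {S} → Between ∅ (V ─ A) k S →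
    ((Between ∅ V k U.∩ Meets W) U.∩ U.∁ (Meets A)) S ⊎ Between ∅ (V ─ A ─ W) k S
  split {S} (e , f , g) with meets? W S
  ... | yes mW = inj₁ (((e , p─q⊆p V A ∘ f , g) , mW) , ⊆─⇒¬Meets V A f)
  ... | no ¬mW = inj₂ (e , ⊆─ f ¬mW , g)
  rearr : ∀ a b c d → a + ((b + c) + d) ≡ ((a + b) + d) + c
  rearr = solve-∀

step : ∀ {K L s} → Theorem K L s → Theorem K L (suc s)
step {K} {L} {s} theorem {N} {k} {l} sizes {V} {m} ∣V∣ n-large {P} P? uniform large = result
  where
  open Sizes sizes
  open ≤-Reasoning
  t : ℕ
  t = 2 + s
  last : Fin (suc t)
  last = fromℕ t
  D : ℕ
  D = bin (s + m) 2 (k last)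
  Q : Fin t → U.Pred (Subset N) 0ℓ
  Q i = P (inject₁ i)
  Q? : ∀ i → U.Decidable (Q i)
  Q? i = P? (inject₁ i)
  T : U.Pred (Subset N) 0ℓ
  T = P last
  T? : U.Decidable T
  T? = P? last
  K≥2 : 2 ≤ K
  K≥2 = ≤-trans (2≤k last) (k≤K last)
  L≥2 : 2 ≤ L
  L≥2 = ≤-trans (2≤k last) (k≤L (fromℕ (suc s)))
  K≤2K²L : K ≤ 2 * (K * K) * L
  K≤2K²L = ≤-trans (m≤m*m K) (≤-trans (m≤n*m (K * K) 2)
    (m≤m*n (2 * (K * K)) L {{>-nonZero (≤-trans (s≤s z≤n) L≥2)}}))
  ∣union∣≤ : (e : Fin t → Subset N) → (∀ i → Q i (e i)) → ∣ union e ∣ ≤ t * K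
  ∣union∣≤ e e∈ = ∣union∣ e (λ i →
    ≤-trans (≤-reflexive (proj₂ (uniform (inject₁ i) (e∈ i)))) (k≤K (inject₁ i)))
  extend : ∀ {A} → ((e , _) : Rainbow Q) → T A → ¬ Meets (union e) A → Rainbow P
  extend (e , e∈ , disjoint) a ¬m = rainbow-snoc {P = P} (e , e∈ , disjoint) a λ i m →
    let (x , x∈e , x∈A) = meets⁻ m in ¬m (meets (∈-union⁺ e i x∈e) x∈A)

  -- The ground set is unchanged while t decreases by one, so `m` becomes `suc m`.
  first : Rainbow Q
  first = large⇒rainbow theorem (prefix sizes) {V} {suc m} (trans ∣V∣ (sym (cong suc (+-suc s m))))
    (≤-trans (*-monoʳ-≤ (2 * (K * K) * L) (n≤1+n (suc s)))
      (≤-trans n-large (≤-reflexive (sym (cong suc (+-suc s m))))))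
    Q? (λ i → uniform (inject₁ i))
    (λ i → subst (λ z → z C k (inject₁ i) + 1 < cnt (Q? i) + suc m C k (inject₁ i))
      (sym (cong suc (+-suc s m)))
      (large-suc (Q? i) t m (k (inject₁ i)) (l (inject₁ i)) (large (inject₁ i))))

  popular : (∀ {A} → T A → Meets (union (proj₁ first)) A) →
    ∃[ x ] (x ∈ union (proj₁ first) × t * K * D < cnt (T? ∩? has? x))
  popular all-meet with Fin.any? (λ x →
    (x ∈? union (proj₁ first)) ×-dec (t * K * D <? cnt (T? ∩? has? x)))
  ... | yes e = e
  ... | no none = contradiction
    (cnt-union T? (union (proj₁ first)) (∣union∣≤ (proj₁ first) (proj₁ (proj₂ first))) all-meet
      (λ {x} x∈ → ≮⇒≥ (λ lt → none (x , x∈ , lt))))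
    (<⇒≱ (degree-large T? {s} {m} {k last} {l last} (2≤k last) (k≤K last) (k≤L (fromℕ (suc s)))
      n-large (large last)))

  module _ {x} (x∈V : x ∈ V) (degree : t * K * D < cnt (T? ∩? has? x)) where

    Q′ : Fin t → U.Pred (Subset N) 0ℓ
    Q′ i = Q i U.∩ U.∁ (x ∈_)
    Q′? : ∀ i → U.Decidable (Q′ i)
    Q′? i = Q? i ∩? ∁? (has? x)
    V′ : Subset N
    V′ = V ─ ⁅ x ⁆

    V′-lacks : x ∉ V′
    V′-lacks x∈ = proj₂ (x∈p─q⁻ V ⁅ x ⁆ x∈) (x∈⁅x⁆ x)

    removed : Rainbow Q′ ⊎ Cover V′ (suc s) Q′
    removed = theorem (prefix sizes) {V′} {m}
      (∣p─q∣ (⁅x⁆⊆ x∈V) (∣⁅x⁆∣≡1 x) (trans ∣V∣ (+-comm 1 (suc s + m))))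
      (s≤s⁻¹ (begin
        suc (2 * (K * K) * L * suc s)                ≤⟨ +-monoˡ-≤ _ (≤-trans (s≤s z≤n) (≤-trans K≥2 K≤2K²L)) ⟩
        2 * (K * K) * L + 2 * (K * K) * L * suc s    ≡⟨ *-suc (2 * (K * K) * L) (suc s) ⟨
        2 * (K * K) * L * (2 + s)                    ≤⟨ n-large ⟩
        2 + s + m                                    ∎))
      Q′?
      (λ i (q , x∉) → ⊆─ (proj₁ (uniform (inject₁ i) q))
        (λ mx → let (y , y∈x , y∈S) = meets⁻ mx in x∉ (subst (_∈ _) (x∈⁅y⁆⇒x≡y x y∈x) y∈S)) ,
        proj₂ (uniform (inject₁ i) q))
      large′
      where
      -- At most `bin (suc s + m) 1 kᵢ` members contain `x`, and the leading coefficient drops by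
      -- exactly this number when n does by one.
      large′ : ∀ i → Large (Q′? i) (suc s) m (k (inject₁ i)) (l (inject₁ i))
      large′ i = linear 0
        (+-mono-≤ (+-mono-≤ (large (inject₁ i)) (cnt-split (Q? i) (has? x)))
          (cnt-star₁ (Q? i ∩? has? x) {r = suc s + m} (uniform (inject₁ i) ∘ proj₁) x∈V
            (trans ∣V∣ (+-comm 1 (suc s + m))) proj₂))
        (trans (ring (cnt (Q? i)) (m C kᵢ) (bin (m ∸ l (inject₁ i)) 1 kᵢ) (cnt (Q? i ∩? has? x))
            (cnt (Q′? i)) ((suc s + m) C kᵢ) (bin (suc s + m) 1 kᵢ))
          (cong (λ z → (cnt (Q′? i) + m C kᵢ + bin (m ∸ l (inject₁ i)) 1 kᵢ) +
              ((suc (z + 1) + cnt (Q? i)) + cnt (Q? i ∩? has? x)))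
            (sym (pascal (suc s + m) 0 kᵢ))))
        where
        kᵢ = k (inject₁ i)
        ring : ∀ q a b c d e f → suc (e + 1) + (((q + a + b) + (c + d)) + f) + 0 ≡
          (d + a + b) + ((suc ((e + f) + 1) + q) + c)
        ring = solve-∀

    -- Otherwise the points of the matching, all different from `x`, would meet every member of `T`
    -- through `x`; together with `x` each of them lies in at most `D` members.
    avoiding : ((e , _) : Rainbow Q′) → ∃[ S ] (T S × ¬ Meets (union e) S)
    avoiding (e , e∈ , _) with ∀⊎∃ (T? ∩? has? x) (meets? (union e))
    ... | inj₂ (S , (a , _) , ¬m) = S , a , ¬m
    ... | inj₁ all-meet = contradiction
      (cnt-union (T? ∩? has? x) (union e) (∣union∣≤ e (proj₁ ∘ e∈)) all-meet λ {y} y∈ →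
        let (i , y∈e) = ∈-union⁻ e y∈ in
        cnt-star₂ ((T? ∩? has? x) ∩? has? y) (uniform last ∘ proj₁ ∘ proj₁) x∈V
          (proj₁ (uniform (inject₁ i) (proj₁ (e∈ i))) y∈e) (λ { refl → proj₂ (e∈ i) y∈e })
          (trans ∣V∣ (+-comm 2 (s + m))) (proj₂ ∘ proj₁) proj₂)
      (<⇒≱ degree)

    cover-Q : Cover V′ (suc s) Q′ → Cover V t Q
    cover-Q (W , W⊆V′ , ∣W∣ , cover) = ⁅ x ⁆ ∪ W , ∪-⊆ (⁅x⁆⊆ x∈V) (p─q⊆p V ⁅ x ⁆ ∘ W⊆V′) ,
      trans (∣⁅x⁆∪p∣ (V′-lacks ∘ W⊆V′)) (cong suc ∣W∣) , covers
      where
      covers : ∀ i {S} → Q i S → Meets (⁅ x ⁆ ∪ W) S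
      covers i {S} q with x ∈? S
      ... | yes x∈S = meets (p⊆p∪q W (x∈⁅x⁆ x)) x∈S
      ... | no x∉S = let (y , y∈W , y∈S) = meets⁻ (cover i (q , x∉S)) in
        meets (q⊆p∪q ⁅ x ⁆ W y∈W) y∈S

  finish : Cover V t Q → Rainbow P ⊎ Cover V t P
  finish (W , W⊆V , ∣W∣ , cover) with ∀⊎∃ T? (meets? W)
  ... | inj₁ coverT = inj₂ (W , W⊆V , ∣W∣ , λ i → covers (view i))
    where
    covers : ∀ {i} → View i → ∀ {S} → P i S → Meets W S
    covers ‵fromℕ = coverT
    covers (‵inject₁ i) = cover i
  ... | inj₂ (A , a , ¬m) = inj₁ (rainbow-snoc {P = P} (e , proj₁ ∘ e∈ , disjoint) a (proj₂ ∘ e∈))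
    where
    A⊆V : A ⊆ V
    A⊆V = proj₁ (uniform last a)
    r : ℕ
    r = proj₁ (m≤n⇒∃[o]m+o≡n {∣ A ∣} {m} (≤-trans (p⊆q⇒∣p∣≤∣q∣ (⊆─ A⊆V ¬m))
      (≤-reflexive (∣p─q∣ W⊆V ∣W∣ (trans ∣V∣ (+-comm t m))))))
    ∣A∣+r≡m : ∣ A ∣ + r ≡ m
    ∣A∣+r≡m = proj₂ (m≤n⇒∃[o]m+o≡n {∣ A ∣} {m} (≤-trans (p⊆q⇒∣p∣≤∣q∣ (⊆─ A⊆V ¬m))
      (≤-reflexive (∣p─q∣ W⊆V ∣W∣ (trans ∣V∣ (+-comm t m))))))
    1+s+1+r : suc s + suc r ≡ t + r
    1+s+1+r = cong suc (+-suc s r)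
    Q″? : ∀ i → U.Decidable (Q i U.∩ U.∁ (Meets A))
    Q″? i = Q? i ∩? ∁? (meets? A)
    -- The loss bounded by `avoiding-large` replaces `m` by `r` in the binomial coefficients. What
    -- remains is at most `bin r 1 kᵢ`, since `A` has at most `l (inject₁ i)` points, and Pascal's
    -- rule yields `suc r C kᵢ`.
    enough : ∀ i → (suc s + suc r) C k (inject₁ i) + 1 < cnt (Q″? i) + suc r C k (inject₁ i)
    enough i = subst (λ z → z C kᵢ + 1 < cnt (Q″? i) + suc r C kᵢ) (sym 1+s+1+r) (linear 0
      (+-mono-≤ (+-mono-≤ (large (inject₁ i)) (cnt-split (Q? i) (meets? A)))
        (+-mono-≤ (avoiding-large (Q? i) {r = r} (uniform (inject₁ i)) W⊆V A⊆V ¬m ∣W∣ ∣A∣+r≡m ∣V∣ (cover i))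
          (bin-mono {m ∸ l (inject₁ i)} {r} 1 kᵢ m∸l≤r)))
      (trans (ring (cnt (Q? i)) (m C kᵢ) (bin (m ∸ l (inject₁ i)) 1 kᵢ) (cnt (Q? i ∩? meets? A))
          (cnt (Q″? i)) ((t + r) C kᵢ) ((t + m) C kᵢ) (r C kᵢ) (bin r 1 kᵢ))
        (cong (λ z → (cnt (Q″? i) + z) + ((suc ((t + m) C kᵢ + 1) + cnt (Q? i)) +
            ((cnt (Q? i ∩? meets? A) + ((t + r) C kᵢ + m C kᵢ)) + bin (m ∸ l (inject₁ i)) 1 kᵢ)))
          (sym (pascal r 0 kᵢ)))))
      where
      kᵢ = k (inject₁ i)
      m∸l≤r : m ∸ l (inject₁ i) ≤ r
      m∸l≤r = begin
        m ∸ l (inject₁ i)   ≤⟨ ∸-monoʳ-≤ m (k≤l (inject₁ i) (fromℕ s)) ⟩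
        m ∸ k last          ≡⟨ cong₂ _∸_ ∣A∣+r≡m (proj₂ (uniform last a)) ⟨
        ∣ A ∣ + r ∸ ∣ A ∣   ≡⟨ m+n∸m≡n ∣ A ∣ r ⟩
        r                   ∎
      ring : ∀ q a b c d e f g h →
        suc (e + 1) + (((q + a + b) + (c + d)) + ((f + g) + h)) + 0 ≡
        (d + (g + h)) + ((suc (f + 1) + q) + ((c + (e + a)) + b))
      ring = solve-∀
    rainbow : Rainbow (λ i → Q i U.∩ U.∁ (Meets A))
    rainbow = large⇒rainbow theorem (prefix sizes) {V ─ A} {suc r}
      (∣p─q∣ A⊆V refl (trans ∣V∣ (trans (cong (t +_) (trans (sym ∣A∣+r≡m) (+-comm ∣ A ∣ r)))
        (trans (sym (+-assoc t r ∣ A ∣)) (cong (_+ ∣ A ∣) (sym 1+s+1+r))))))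
      -- Deleting `A` costs at most `K` points, while decreasing t by one gains `2 * (K * K) * L`.
      (+-cancelˡ-≤ (2 * (K * K) * L) _ _ (begin
        2 * (K * K) * L + 2 * (K * K) * L * suc s    ≡⟨ *-suc (2 * (K * K) * L) (suc s) ⟨
        2 * (K * K) * L * (2 + s)                    ≤⟨ n-large ⟩
        t + m                                        ≡⟨ cong (t +_) ∣A∣+r≡m ⟨
        t + (∣ A ∣ + r)                              ≡⟨ ring t (∣ A ∣) r ⟩
        ∣ A ∣ + (t + r)                              ≤⟨ +-monoˡ-≤ (t + r) (≤-trans
          (≤-reflexive (proj₂ (uniform last a))) (≤-trans (k≤K last) K≤2K²L)) ⟩
        2 * (K * K) * L + (t + r)                    ≡⟨ cong (2 * (K * K) * L +_) 1+s+1+r ⟨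
        2 * (K * K) * L + (suc s + suc r)            ∎))
      Q″? (λ i (q , ¬mA) → ⊆─ (proj₁ (uniform (inject₁ i) q)) ¬mA , proj₂ (uniform (inject₁ i) q))
      enough
      where
      ring : ∀ t a r → t + (a + r) ≡ a + (t + r)
      ring = solve-∀
    e : Fin t → Subset N
    e = proj₁ rainbow
    e∈ : ∀ i → Q i (e i) × ¬ Meets (e i) A
    e∈ i = let (q , ¬mA) = proj₁ (proj₂ rainbow) i in q , ¬mA ∘ Meets-sym
    disjoint : ∀ i j → i ≢ j → Empty (e i ∩ e j)
    disjoint = proj₂ (proj₂ rainbow)

  result : Rainbow P ⊎ Cover V t P
  result with ∀⊎∃ T? (meets? (union (proj₁ first)))
  ... | inj₂ (S , a , ¬m) = inj₁ (extend first a ¬m)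
  ... | inj₁ all-meet with popular all-meet
  ...   | x , x∈U , degree with ∈-union⁻ (proj₁ first) x∈U
  ...     | i , x∈e = go (removed x∈V degree)
    where
    x∈V : x ∈ V
    x∈V = proj₁ (uniform (inject₁ i) (proj₁ (proj₂ first) i)) x∈e
    go : Rainbow (Q′ x∈V degree) ⊎ Cover (V′ x∈V degree) (suc s) (Q′ x∈V degree) → Rainbow P ⊎ Cover V t P
    go (inj₁ rainbow@(e , e∈ , disjoint)) =
      let (S , a , ¬m) = avoiding x∈V degree rainbow in
      inj₁ (extend (e , proj₁ ∘ e∈ , disjoint) a ¬m)
    go (inj₂ cover) = finish (cover-Q x∈V degree cover)

-- Return to families given by lists.

rainbow⊎cover : ∀ {K L} → L ≤ K → ∀ s → Theorem K L s
rainbow⊎cover L≤K zero = base L≤K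
rainbow⊎cover L≤K (suc s) = step (rainbow⊎cover L≤K s)

2≤k⇒bin₁ : ∀ r {k} → 2 ≤ k → bin r 1 k ≡ r C (k ∸ 1)
2≤k⇒bin₁ r (s≤s _) = refl

-- As `k` is antitone, the second number in each bound is at least the set size of every family from
-- the third on; this is the field `k≤l`.
partner-≤ : ∀ {s} (i : Fin (2 + s)) (j : Fin s) → partner i Fin.≤ Fin.suc (Fin.suc j)
partner-≤ zero j = s≤s z≤n
partner-≤ (suc zero) j = z≤n
partner-≤ {suc s} (suc (suc i)) j = s≤s (s≤s z≤n)

-- `a` is at most `b + (a ∸ b)` even when the subtraction is truncated, so both subtractions move to
-- the other side without side conditions.
bound-large : ∀ n t m k l c → 2 ≤ k → t + m ≡ n → bound n t k l < c →
  n C k + 1 < c + m C k + bin (m ∸ l) 1 k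
bound-large n t m k l c 2≤k refl h rewrite m+n∸m≡n t m | 2≤k⇒bin₁ (m ∸ l) 2≤k = begin-strict
  a + 1                           ≤⟨ +-monoˡ-≤ 1 (≤-trans (m≤n+m∸n a b) (+-monoʳ-≤ b (m≤n+m∸n (a ∸ b) d))) ⟩
  b + (d + (a ∸ b ∸ d)) + 1       ≡⟨ ring b d (a ∸ b ∸ d) ⟩
  (a ∸ b ∸ d) + 1 + b + d         <⟨ +-monoˡ-< d (+-monoˡ-< b h) ⟩
  c + b + d                       ∎
  where
  open ≤-Reasoning
  a = (t + m) C k
  b = m C k
  d = (m ∸ l) C (k ∸ 1)
  ring : ∀ b d x → b + (d + x) + 1 ≡ x + 1 + b + d
  ring = solve-∀

theorem1p2 : (n s : ℕ) (let t = suc s) (k : Fin (suc t) → ℕ) →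
    Antitonic₁ Fin._≤_ _≤_ k →
    2 ≤ k (fromℕ t) →
    2 * k zero ^ 2 * k (suc zero) * t ≤ n →
    (F : ∀ i → Family n (k i)) →
    (∀ i → bound n t (k i) (k (partner i)) < card (F i)) →
    RainbowMatching F ⊎
    (Σ[ W ∈ Subset n ] (∣ W ∣ ≡ t × (∀ i → VertexCover W (F i))))
theorem1p2 n s k antitone 2≤kₜ n-large F card-large = conclude
  (rainbow⊎cover (antitone z≤n) s sizes {full} {n ∸ t} (trans (∣⊤∣≡n n) (sym t+m≡n))
    (≤-trans n-large′ (≤-reflexive (sym t+m≡n)))
    member? (λ i A∈ → ⊆-max _ , All.lookup (uniform (F i)) A∈) large)
  where
  t = suc s
  member? : ∀ i → U.Decidable (_∈ˡ members (F i))
  member? i A = DecMembership._∈?_ (Vec.≡-dec Bool._≟_) A (members (F i))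
  2≤k : ∀ i → 2 ≤ k i
  2≤k i = ≤-trans 2≤kₜ (antitone (Fin.≤fromℕ i))
  n-large′ : 2 * (k zero * k zero) * k (suc zero) * t ≤ n
  n-large′ = ≤-trans (≤-reflexive (cong (λ z → 2 * (k zero * z) * k (suc zero) * t)
    (sym (*-identityʳ (k zero))))) n-large
  t+m≡n : t + (n ∸ t) ≡ n
  t+m≡n = m+[n∸m]≡n (≤-trans (m≤n*m t (2 * (k zero * k zero) * k (suc zero))
    {{>-nonZero (≤-trans (s≤s z≤n) (1+l≤2l²k (2≤k (suc zero)) (2≤k zero)))}}) n-large′)
  sizes : Sizes (k zero) (k (suc zero)) s k (k ∘ partner)
  sizes = record
    { 2≤k = 2≤k ; k≤K = λ i → antitone z≤n ; k≤L = λ i → antitone (s≤s z≤n)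
    ; k₁≤l₀ = ≤-refl ; k₀≤l₁ = ≤-refl ; k≤l = λ i j → antitone (partner-≤ i j) }
  large : ∀ i → Large (member? i) t (n ∸ t) (k i) (k (partner i))
  large i = subst (λ z → z C k i + 1 < cnt (member? i) + (n ∸ t) C k i + bin (n ∸ t ∸ k (partner i)) 1 (k i))
    (sym t+m≡n)
    (bound-large n t (n ∸ t) (k i) (k (partner i)) (cnt (member? i)) (2≤k i) t+m≡n
      (≤-trans (card-large i) (length≤cnt (member? i) (unique (F i)) (All.tabulate id))))
  conclude : Rainbow (λ i → _∈ˡ members (F i)) ⊎ Cover full t (λ i → _∈ˡ members (F i)) →
    RainbowMatching F ⊎ (Σ[ W ∈ Subset n ] (∣ W ∣ ≡ t × (∀ i → VertexCover W (F i))))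
  conclude (inj₁ rainbow) = inj₁ rainbow
  conclude (inj₂ (W , _ , ∣W∣ , cover)) = inj₂ (W , ∣W∣ , λ i → All.tabulate (cover i))
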